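{- The sequent calculus $\mathsf{G4WK}$ has the uniform interpolation property: there exist assignments giving, for each propositional variable $p$ and each finite multiset $\Gamma$ of formulas, a formula $E_p(\Gamma)$, and for each propositional variable $p$ and each $\mathsf{G4WK}$-sequent $\Gamma\Rightarrow\Delta$ (so $|\Delta|\le 1$), a formula $A_p(\Gamma\Rightarrow\Delta)$, such that for all $p$, $\Gamma$, $\Delta$ with $|\Delta|\le1$: (1) ($p$-freeness) the variables of $E_p(\Gamma)$ are among those of $\Gamma$ other than $p$, and the variables of $A_p(\Gamma\Rightarrow\Delta)$ are among those of $\Gamma\cup\Delta$ other than $p$; (2) (implication) $\vdash_{\mathsf{G4WK}}\Gamma\Rightarrow E_p(\Gamma)$ and $\vdash_{\mathsf{G4WK}}\Gamma, A_p(\Gamma\Rightarrow\Delta)\Rightarrow\Delta$; (3) (uniformity) for every finite multiset $\Pi$ of formulas in which $p$ does not occur, if $\vdash_{\mathsf{G4WK}}\Pi,\Gamma\Rightarrow\Delta$ then (a) $\vdash_{\mathsf{G4WK}}\Pi,E_p(\Gamma)\Rightarrow\Delta$ provided $p$ does not occur in $\Delta$, and (b) $\vdash_{\mathsf{G4WK}}\Pi,E_p(\Gamma)\Rightarrow A_p(\Gamma\Rightarrow\Delta)$.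
   Context: Formulas are built from a countably infinite set $\mathsf{Prop}$ of propositional variables by $\varphi ::= p \mid \bot \mid \varphi\wedge\varphi \mid \varphi\vee\varphi \mid \varphi\to\varphi \mid \Box\varphi \mid \Diamond\varphi$. For a multiset $\Gamma$ of formulas, $\Box^{ -1}\Gamma=\{\varphi \mid \Box\varphi\in\Gamma\}$ and $\Diamond^{ -1}\Gamma=\{\varphi\mid\Diamond\varphi\in\Gamma\}$ (with multiplicities). A sequent is $\Gamma\Rightarrow\Delta$ with $\Gamma,\Delta$ finite multisets of formulas; $\Gamma,\varphi$ means $\Gamma\uplus\{\varphi\}$, $\Gamma,\Pi$ means $\Gamma\uplus\Pi$, and a single formula on the right denotes a singleton. In $\mathsf{G4WK}$ succedents have at most one element. The rules of $\mathsf{G4WK}$ ($p\in\mathsf{Prop}$, $\Delta$ any succedent with $|\Delta|\le1$): ($\bot$L) $\Gamma,\bot\Rightarrow\Delta$ with no premises; (IdP) $\Gamma,p\Rightarrow p$ with no premises; ($\wedge$L) from $\Gamma,\varphi,\psi\Rightarrow\Delta$ infer $\Gamma,\varphi\wedge\psi\Rightarrow\Delta$; ($\wedge$R) from $\Gamma\Rightarrow\varphi$ and $\Gamma\Rightarrow\psi$ infer $\Gamma\Rightarrow\varphi\wedge\psi$; ($\vee$L) from $\Gamma,\varphi\Rightarrow\Delta$ and $\Gamma,\psi\Rightarrow\Delta$ infer $\Gamma,\varphi\vee\psi\Rightarrow\Delta$; ($\vee$R$_i$) from $\Gamma\Rightarrow\varphi_i$ infer $\Gamma\Rightarrow\varphi_1\vee\varphi_2$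 ($i=1,2$); ($\to$R) from $\Gamma,\varphi\Rightarrow\psi$ infer $\Gamma\Rightarrow\varphi\to\psi$; ($\wedge\!\to$L) from $\Gamma,\varphi\to(\psi\to\chi)\Rightarrow\Delta$ infer $\Gamma,(\varphi\wedge\psi)\to\chi\Rightarrow\Delta$; ($\vee\!\to$L) from $\Gamma,\varphi\to\chi,\psi\to\chi\Rightarrow\Delta$ infer $\Gamma,(\varphi\vee\psi)\to\chi\Rightarrow\Delta$; ($p\!\to$L) from $\Gamma,p,\varphi\Rightarrow\Delta$ infer $\Gamma,p,p\to\varphi\Rightarrow\Delta$; ($\to\to$L) from $\Gamma,\psi\to\chi\Rightarrow\varphi\to\psi$ and $\Gamma,\chi\Rightarrow\Delta$ infer $\Gamma,(\varphi\to\psi)\to\chi\Rightarrow\Delta$; ($\Box$R) from $\Box^{ -1}\Gamma\Rightarrow\varphi$ infer $\Gamma\Rightarrow\Box\varphi$; ($\Box\!\to$L) from $\Box^{ -1}\Gamma\Rightarrow\varphi$ and $\Gamma,\psi\Rightarrow\Delta$ infer $\Gamma,\Box\varphi\to\psi\Rightarrow\Delta$; ($\Diamond\!\to$L) from $\Box^{ -1}\Gamma,\gamma\Rightarrow\varphi$ and $\Gamma,\Diamond\gamma,\psi\Rightarrow\Delta$ infer $\Gamma,\Diamond\gamma,\Diamond\varphi\to\psi\Rightarrow\Delta$; ($\Diamond$L$'$) from $\Box^{ -1}\Gamma,\varphi\Rightarrow\Diamond^{ -1}\Delta$ infer $\Gamma,\Diamond\varphi\Rightarrow\Delta$ (the premise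 succedent is $\{\delta\}$ if $\Delta=\{\Diamond\delta\}$ and empty otherwise). $\vdash_{\mathsf{G4WK}}\Gamma\Rightarrow\Delta$ means the sequent has a finite derivation in these rules. -}

module Defs where

open import Data.Nat using (ℕ)
open import Data.List using (List; []; _∷_; _++_)
open import Data.List.Relation.Binary.Permutation.Propositional using (_↭_)
open import Data.List.Relation.Unary.Any using (Any)
open import Data.Maybe using (Maybe; just; nothing)

Var : Set
Var = ℕ

infixr 6 _∧'_
infixr 5 _∨'_
infixr 4 _⇒_

data Form : Set where
  var  : Var → Form
  ⊥'   : Form
  _∧'_ : Form → Form → Form
  _∨'_ : Form → Form → Form
  _⇒_  : Form → Form → Form
  □    : Form → Form
  ◇    : Form → Form

data Occ (p : Var) : Form → Set where
  here : Occ p (var p)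
  ∧l : ∀ {φ ψ} → Occ p φ → Occ p (φ ∧' ψ)
  ∧r : ∀ {φ ψ} → Occ p ψ → Occ p (φ ∧' ψ)
  ∨l : ∀ {φ ψ} → Occ p φ → Occ p (φ ∨' ψ)
  ∨r : ∀ {φ ψ} → Occ p ψ → Occ p (φ ∨' ψ)
  ⇒l : ∀ {φ ψ} → Occ p φ → Occ p (φ ⇒ ψ)
  ⇒r : ∀ {φ ψ} → Occ p ψ → Occ p (φ ⇒ ψ)
  □o : ∀ {φ} → Occ p φ → Occ p (□ φ)
  ◇o : ∀ {φ} → Occ p φ → Occ p (◇ φ)

OccL : Var → List Form → Set
OccL p Γ = Any (Occ p) Γ

OccM : Var → Maybe Form → Set
OccM p nothing  = ⊥ where open import Data.Empty using (⊥)
OccM p (just φ) = Occ p φ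

boxInv : List Form → List Form
boxInv [] = []
boxInv (□ φ ∷ Γ) = φ ∷ boxInv Γ
boxInv (_ ∷ Γ) = boxInv Γ

diaInv : Maybe Form → Maybe Form
diaInv (just (◇ δ)) = just δ
diaInv _ = nothing

-- Derivability in G4WK. Antecedents are multisets, represented by lists
-- taken up to permutation (_↭_); succedents (|Δ| ≤ 1) are Maybe Form.
infix 3 _⊢_
data _⊢_ : List Form → Maybe Form → Set where
  ⊥L  : ∀ {Γ Γ₀ Δ} → Γ ↭ (⊥' ∷ Γ₀) → Γ ⊢ Δ
  IdP : ∀ {Γ Γ₀ p} → Γ ↭ (var p ∷ Γ₀) → Γ ⊢ just (var p)
  ∧L  : ∀ {Γ Γ₀ Δ φ ψ} → Γ ↭ ((φ ∧' ψ) ∷ Γ₀) → (φ ∷ ψ ∷ Γ₀) ⊢ Δ → Γ ⊢ Δ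
  ∧R  : ∀ {Γ φ ψ} → Γ ⊢ just φ → Γ ⊢ just ψ → Γ ⊢ just (φ ∧' ψ)
  ∨L  : ∀ {Γ Γ₀ Δ φ ψ} → Γ ↭ ((φ ∨' ψ) ∷ Γ₀) → (φ ∷ Γ₀) ⊢ Δ → (ψ ∷ Γ₀) ⊢ Δ → Γ ⊢ Δ
  ∨R₁ : ∀ {Γ φ ψ} → Γ ⊢ just φ → Γ ⊢ just (φ ∨' ψ)
  ∨R₂ : ∀ {Γ φ ψ} → Γ ⊢ just ψ → Γ ⊢ just (φ ∨' ψ)
  ⇒R  : ∀ {Γ φ ψ} → (φ ∷ Γ) ⊢ just ψ → Γ ⊢ just (φ ⇒ ψ)
  ∧⇒L : ∀ {Γ Γ₀ Δ φ ψ χ} → Γ ↭ (((φ ∧' ψ) ⇒ χ) ∷ Γ₀) →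
        ((φ ⇒ (ψ ⇒ χ)) ∷ Γ₀) ⊢ Δ → Γ ⊢ Δ
  ∨⇒L : ∀ {Γ Γ₀ Δ φ ψ χ} → Γ ↭ (((φ ∨' ψ) ⇒ χ) ∷ Γ₀) →
        ((φ ⇒ χ) ∷ (ψ ⇒ χ) ∷ Γ₀) ⊢ Δ → Γ ⊢ Δ
  p⇒L : ∀ {Γ Γ₀ Δ p φ} → Γ ↭ (var p ∷ (var p ⇒ φ) ∷ Γ₀) →
        (var p ∷ φ ∷ Γ₀) ⊢ Δ → Γ ⊢ Δ
  ⇒⇒L : ∀ {Γ Γ₀ Δ φ ψ χ} → Γ ↭ (((φ ⇒ ψ) ⇒ χ) ∷ Γ₀) →
        ((ψ ⇒ χ) ∷ Γ₀) ⊢ just (φ ⇒ ψ) → (χ ∷ Γ₀) ⊢ Δ → Γ ⊢ Δ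
  □R  : ∀ {Γ φ} → boxInv Γ ⊢ just φ → Γ ⊢ just (□ φ)
  □⇒L : ∀ {Γ Γ₀ Δ φ ψ} → Γ ↭ ((□ φ ⇒ ψ) ∷ Γ₀) →
        boxInv Γ₀ ⊢ just φ → (ψ ∷ Γ₀) ⊢ Δ → Γ ⊢ Δ
  ◇⇒L : ∀ {Γ Γ₀ Δ γ φ ψ} → Γ ↭ (◇ γ ∷ (◇ φ ⇒ ψ) ∷ Γ₀) →
        (γ ∷ boxInv Γ₀) ⊢ just φ → (◇ γ ∷ ψ ∷ Γ₀) ⊢ Δ → Γ ⊢ Δ
  ◇L' : ∀ {Γ Γ₀ Δ φ} → Γ ↭ (◇ φ ∷ Γ₀) →
        (φ ∷ boxInv Γ₀) ⊢ diaInv Δ → Γ ⊢ Δ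

{-# OPTIONS --safe #-}

-- Pitts' method. E_p(Γ) is a conjunction and A_p(Γ ⇒ Δ) a disjunction with one member for each way in
-- which a formula of Γ or Δ can be principal in the last rule of a derivation of Π, Γ ⇒ Δ whose
-- context Π is p-free but unknown; a premise Π', Γ' ⇒ Δ' enters through E_p(Γ') and A_p(Γ' ⇒ Δ'),
-- where (Γ', Δ') is smaller in the multiset order. A premise that replaces Δ by a formula of Γ enters
-- as E_p(Γ') → A_p(Γ' ⇒ Δ'); it is prefixed by □ or ◇ in the modal rules, according as the principal
-- diamond, if any, lies in Γ or in Π. Uniformity is then an induction on derivations in which the last
-- rule either acts on Π and is repeated, or selects the corresponding member of E_p or A_p. Neither
-- cut nor contraction is needed, only weakening, invertibility of the invertible left rules, and the
-- admissibility of implication on the left (from Γ ⇒ φ and Γ, ψ ⇒ Δ infer Γ, φ → ψ ⇒ Δ).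
module Submission where

open import Defs
open import Data.Empty using (⊥-elim)
open import Data.List using (List; []; _∷_; _++_; map; mapMaybe; concatMap; foldr; foldl)
open import Data.List.Membership.Propositional using (_∈_; lose)
open import Data.List.Membership.Propositional.Properties
  using (∈-∃++; ∈-concatMap⁺; ∈-map⁺; ∈-map⁻; ∈-++⁻; ∈-++⁺ˡ; ∈-++⁺ʳ)
open import Data.List.Properties using (mapMaybe-++; map-++; foldl-++; ∷-injectiveˡ)
open import Data.List.Relation.Binary.Lex.Strict using (≤-decTotalOrder)
open import Data.List.Relation.Binary.Permutation.Propositional
  using (_↭_; refl; prep; swap; trans; ↭-sym; ↭-reflexive; ↭⇒↭ₛ′)
open import Data.List.Relation.Binary.Permutation.Propositional.Properties as Perm
  using (++⁺ˡ; ++⁺ʳ; ++-assoc; ++-comm; ++-identityʳ; shift; shifts; drop-∷;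
         ∈-resp-↭; All-resp-↭; mapMaybe-↭)
open import Data.List.Relation.Binary.Pointwise as Pointwise using (Pointwise-≡⇒≡)
open import Data.List.Relation.Unary.All as All using (All; []; _∷_)
open import Data.List.Relation.Unary.All.Properties using (map⁺; concat⁺; ++⁺)
open import Data.List.Relation.Unary.Any using (here; there)
import Data.List.Relation.Unary.Sorted.TotalOrder.Properties as Sorted
import Data.List.Sort
open import Data.Maybe using (Maybe; just; nothing)
open import Data.Nat using (ℕ; zero; suc; _+_; _^_; _≤_; _<_; z≤n; s≤s)
open import Data.Nat.ListAction using (sum)
open import Data.Nat.ListAction.Properties using (sum-++; sum-↭)
open import Data.Nat.Properties as ℕ using (_≟_)
open import Data.List.Membership.DecPropositional _≟_ using (_∈?_)
open import Data.Product using (Σ; ∃; _×_; _,_)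
open import Data.Sum using (_⊎_; inj₁; inj₂)
open import Function using (_∘_; case_of_)
open import Relation.Binary.Bundles using (DecTotalOrder)
import Relation.Binary.Construct.On as On
open import Relation.Binary.PropositionalEquality as Eq using (_≡_; refl; sym; cong; subst)
open import Relation.Nullary using (¬_; Dec; yes; no; ¬?)

private variable
  Γ Γ₀ Γ' Π Σ' Σ₀ Θ gs hs : List Form
  Δ Δ' : Maybe Form
  x y f B C : Form

-- Unboxing and permutations of antecedents.

unbox : Form → Maybe Form
unbox (□ φ) = just φ
unbox _ = nothing

-- Opens `boxInv` to the general facts on `mapMaybe`: compatibility with permutation and
-- concatenation.
boxInv≡mapMaybe : ∀ Γ → boxInv Γ ≡ mapMaybe unbox Γ
boxInv≡mapMaybe [] = refl
boxInv≡mapMaybe (var _ ∷ Γ) = boxInv≡mapMaybe Γ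
boxInv≡mapMaybe (⊥' ∷ Γ) = boxInv≡mapMaybe Γ
boxInv≡mapMaybe ((_ ∧' _) ∷ Γ) = boxInv≡mapMaybe Γ
boxInv≡mapMaybe ((_ ∨' _) ∷ Γ) = boxInv≡mapMaybe Γ
boxInv≡mapMaybe ((_ ⇒ _) ∷ Γ) = boxInv≡mapMaybe Γ
boxInv≡mapMaybe (□ φ ∷ Γ) = cong (φ ∷_) (boxInv≡mapMaybe Γ)
boxInv≡mapMaybe (◇ _ ∷ Γ) = boxInv≡mapMaybe Γ

boxInv-↭ : Γ ↭ Γ' → boxInv Γ ↭ boxInv Γ'
boxInv-↭ {Γ} {Γ'} r rewrite boxInv≡mapMaybe Γ | boxInv≡mapMaybe Γ' = mapMaybe-↭ unbox r

boxInv-++ : ∀ Γ Θ → boxInv (Γ ++ Θ) ≡ boxInv Γ ++ boxInv Θ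
boxInv-++ Γ Θ rewrite boxInv≡mapMaybe (Γ ++ Θ) | boxInv≡mapMaybe Γ | boxInv≡mapMaybe Θ =
  mapMaybe-++ unbox Γ Θ

boxInv-↭-++ : ∀ Γ Θ → Σ' ↭ Γ ++ Θ → boxInv Σ' ↭ boxInv Γ ++ boxInv Θ
boxInv-↭-++ Γ Θ r = trans (boxInv-↭ r) (↭-reflexive (boxInv-++ Γ Θ))

under : Γ ↭ x ∷ Γ₀ → y ∷ Γ ↭ x ∷ y ∷ Γ₀
under r = trans (prep _ r) (swap _ _ refl)

rot : x ∷ y ∷ f ∷ Γ ↭ f ∷ x ∷ y ∷ Γ
rot = shift _ (_ ∷ _ ∷ []) _

rot⁻¹ : x ∷ y ∷ f ∷ Γ ↭ y ∷ f ∷ x ∷ Γ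
rot⁻¹ = ↭-sym (shift _ (_ ∷ _ ∷ []) _)

under⁺ : ∀ gs → Γ ↭ x ∷ Γ₀ → gs ++ Γ ↭ x ∷ gs ++ Γ₀
under⁺ gs r = trans (++⁺ˡ gs r) (shift _ gs _)

∈⇒↭∷ : x ∈ Γ → ∃ λ Γ₀ → Γ ↭ x ∷ Γ₀
∈⇒↭∷ i with h , t , refl ← ∈-∃++ i = h ++ t , shift _ h t

-- Used when the last rule has principal formula `x` and inversion acts on `f`: they are one
-- occurrence, or two different ones.
∷-↭-∷ : f ∷ Γ ↭ x ∷ Σ₀ → (f ≡ x × Γ ↭ Σ₀) ⊎ ∃ λ Θ → Γ ↭ x ∷ Θ × Σ₀ ↭ f ∷ Θ
∷-↭-∷ r with ∈-resp-↭ (↭-sym r) (here refl)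
... | here refl = inj₁ (refl , drop-∷ r)
... | there i with Θ , s ← ∈⇒↭∷ i = inj₂ (Θ , s , drop-∷ (trans (↭-sym r) (under s)))

-- Multiset inclusion and weakening on either side.

infix 4 _⊑_
-- Inclusion up to permutation is preserved by `boxInv`, so a single induction along it yields
-- weakening and exchange together, also in the modal rules.
_⊑_ : List Form → List Form → Set
Γ ⊑ Γ' = ∃ λ Θ → Γ' ↭ Γ ++ Θ

⊑-reflexive : Γ ↭ Γ' → Γ ⊑ Γ'
⊑-reflexive r = [] , trans (↭-sym r) (↭-sym (++-identityʳ _))

⊑-trans : Γ ⊑ Γ' → Γ' ⊑ Θ → Γ ⊑ Θ
⊑-trans (Θ₁ , r) (Θ₂ , s) = Θ₁ ++ Θ₂ , trans s (trans (++⁺ʳ Θ₂ r) (++-assoc _ Θ₁ Θ₂))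

⊑-prep : Γ ⊑ Γ' → x ∷ Γ ⊑ x ∷ Γ'
⊑-prep (Θ , r) = Θ , prep _ r

⊑-drop : ∀ gs → Γ ⊑ gs ++ Γ
⊑-drop gs = gs , ++-comm gs _

⊑-boxInv : Γ ⊑ Γ' → boxInv Γ ⊑ boxInv Γ'
⊑-boxInv (Θ , r) = boxInv Θ , boxInv-↭-++ _ Θ r

wk : Γ ⊑ Γ' → Γ ⊢ Δ → Γ' ⊢ Δ
wk (Θ , s) (⊥L r) = ⊥L (trans s (++⁺ʳ Θ r))
wk (Θ , s) (IdP r) = IdP (trans s (++⁺ʳ Θ r))
wk (Θ , s) (∧L r d) = ∧L (trans s (++⁺ʳ Θ r)) (wk (Θ , refl) d)
wk s (∧R d e) = ∧R (wk s d) (wk s e)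
wk (Θ , s) (∨L r d e) = ∨L (trans s (++⁺ʳ Θ r)) (wk (Θ , refl) d) (wk (Θ , refl) e)
wk s (∨R₁ d) = ∨R₁ (wk s d)
wk s (∨R₂ d) = ∨R₂ (wk s d)
wk s (⇒R d) = ⇒R (wk (⊑-prep s) d)
wk (Θ , s) (∧⇒L r d) = ∧⇒L (trans s (++⁺ʳ Θ r)) (wk (Θ , refl) d)
wk (Θ , s) (∨⇒L r d) = ∨⇒L (trans s (++⁺ʳ Θ r)) (wk (Θ , refl) d)
wk (Θ , s) (p⇒L r d) = p⇒L (trans s (++⁺ʳ Θ r)) (wk (Θ , refl) d)
wk (Θ , s) (⇒⇒L r d e) = ⇒⇒L (trans s (++⁺ʳ Θ r)) (wk (Θ , refl) d) (wk (Θ , refl) e)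
wk s (□R d) = □R (wk (⊑-boxInv s) d)
wk (Θ , s) (□⇒L {Γ₀ = Γ₀} r d e) =
  □⇒L (trans s (++⁺ʳ Θ r)) (wk (⊑-boxInv {Γ = Γ₀} (Θ , refl)) d) (wk (Θ , refl) e)
wk (Θ , s) (◇⇒L {Γ₀ = Γ₀} r d e) =
  ◇⇒L (trans s (++⁺ʳ Θ r)) (wk (⊑-prep (⊑-boxInv {Γ = Γ₀} (Θ , refl))) d) (wk (Θ , refl) e)
wk (Θ , s) (◇L' {Γ₀ = Γ₀} r d) = ◇L' (trans s (++⁺ʳ Θ r)) (wk (⊑-prep (⊑-boxInv {Γ = Γ₀} (Θ , refl))) d)

exch : Γ ↭ Γ' → Γ ⊢ Δ → Γ' ⊢ Δ
exch r = wk (⊑-reflexive r)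

wk∷ : Γ ⊢ Δ → x ∷ Γ ⊢ Δ
wk∷ {x = x} = wk (⊑-drop (x ∷ []))

-- Only left rules end in an empty succedent, and they leave it arbitrary. The premise of `◇L'` is
-- then also empty on the right, so the induction can fill it with `diaInv Δ`.
rwk : Γ ⊢ nothing → Γ ⊢ Δ
rwk (⊥L r) = ⊥L r
rwk (∧L r d) = ∧L r (rwk d)
rwk (∨L r d e) = ∨L r (rwk d) (rwk e)
rwk (∧⇒L r d) = ∧⇒L r (rwk d)
rwk (∨⇒L r d) = ∨⇒L r (rwk d)
rwk (p⇒L r d) = p⇒L r (rwk d)
rwk (⇒⇒L r d e) = ⇒⇒L r d (rwk e)
rwk (□⇒L r d e) = □⇒L r d (rwk e)
rwk (◇⇒L r d e) = ◇⇒L r d (rwk e)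
rwk (◇L' r d) = ◇L' r (rwk d)

-- Inversion of left rules.

-- f ⇝ gs: replacing f by gs on the left of a derivable sequent preserves derivability (inv below).
infix 3 _⇝_
data _⇝_ : Form → List Form → Set where
  ∧⇝  : ∀ {φ ψ} → φ ∧' ψ ⇝ φ ∷ ψ ∷ []
  ∨⇝₁ : ∀ {φ ψ} → φ ∨' ψ ⇝ φ ∷ []
  ∨⇝₂ : ∀ {φ ψ} → φ ∨' ψ ⇝ ψ ∷ []
  ∧⇒⇝ : ∀ {φ ψ χ} → (φ ∧' ψ) ⇒ χ ⇝ (φ ⇒ (ψ ⇒ χ)) ∷ []
  ∨⇒⇝ : ∀ {φ ψ χ} → (φ ∨' ψ) ⇒ χ ⇝ (φ ⇒ χ) ∷ (ψ ⇒ χ) ∷ []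
  p⇒⇝ : ∀ {p φ} → var p ⇒ φ ⇝ φ ∷ []
  ⇒⇒⇝ : ∀ {φ ψ χ} → (φ ⇒ ψ) ⇒ χ ⇝ χ ∷ []
  □⇒⇝ : ∀ {φ ψ} → □ φ ⇒ ψ ⇝ ψ ∷ []
  ◇⇒⇝ : ∀ {φ ψ} → ◇ φ ⇒ ψ ⇝ ψ ∷ []

-- No formula on the left of `_⇝_` is a box, so unboxing forgets `f`; `gs` may contain boxes, whence
-- an inclusion and not a permutation.
⇝-boxInv : f ⇝ gs → Σ₀ ↭ f ∷ Θ → boxInv Σ₀ ⊑ boxInv (gs ++ Θ)
⇝-boxInv {f} {gs} {Θ = Θ} w r = ⊑-trans (⊑-reflexive (trans (boxInv-↭ r) (↭-reflexive (drop w))))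
  (⊑-boxInv (⊑-drop gs))
  where
  drop : f ⇝ gs → boxInv (f ∷ Θ) ≡ boxInv Θ
  drop ∧⇝ = refl
  drop ∨⇝₁ = refl
  drop ∨⇝₂ = refl
  drop ∧⇒⇝ = refl
  drop ∨⇒⇝ = refl
  drop p⇒⇝ = refl
  drop ⇒⇒⇝ = refl
  drop □⇒⇝ = refl
  drop ◇⇒⇝ = refl

-- If `f` is principal, the claim is a premise up to exchange; otherwise the replacement permutes
-- above the last rule, and premises built with `boxInv` are merely weakened. Taking the permutation
-- as an argument keeps the recursion structural.
inv : f ⇝ gs → Σ' ↭ f ∷ Γ → Σ' ⊢ Δ → gs ++ Γ ⊢ Δ
inv {gs = gs} w t (⊥L r) with ∷-↭-∷ (trans (↭-sym t) r)
inv () t (⊥L r) | inj₁ (refl , _)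
inv {gs = gs} w t (⊥L r) | inj₂ (_ , a , _) = ⊥L (under⁺ gs a)
inv {gs = gs} w t (IdP r) with ∷-↭-∷ (trans (↭-sym t) r)
inv () t (IdP r) | inj₁ (refl , _)
inv {gs = gs} w t (IdP r) | inj₂ (_ , a , _) = IdP (under⁺ gs a)
inv {gs = gs} w t (∧L {φ = φ} {ψ} r d) with ∷-↭-∷ (trans (↭-sym t) r)
inv ∧⇝ t (∧L r d) | inj₁ (refl , s) = exch (prep _ (prep _ (↭-sym s))) d
inv {gs = gs} w t (∧L {φ = φ} {ψ} r d) | inj₂ (_ , a , b) =
  ∧L (under⁺ gs a) (exch (shifts gs (φ ∷ ψ ∷ [])) (inv w (under⁺ (φ ∷ ψ ∷ []) b) d))
inv w t (∧R d e) = ∧R (inv w t d) (inv w t e)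
inv {gs = gs} w t (∨L r d e) with ∷-↭-∷ (trans (↭-sym t) r)
inv ∨⇝₁ t (∨L r d e) | inj₁ (refl , s) = exch (prep _ (↭-sym s)) d
inv ∨⇝₂ t (∨L r d e) | inj₁ (refl , s) = exch (prep _ (↭-sym s)) e
inv {gs = gs} w t (∨L {φ = φ} {ψ} r d e) | inj₂ (_ , a , b) =
  ∨L (under⁺ gs a) (exch (shifts gs (φ ∷ [])) (inv w (under b) d))
                   (exch (shifts gs (ψ ∷ [])) (inv w (under b) e))
inv w t (∨R₁ d) = ∨R₁ (inv w t d)
inv w t (∨R₂ d) = ∨R₂ (inv w t d)
inv {gs = gs} w t (⇒R d) = ⇒R (exch (shift _ gs _) (inv w (under t) d))
inv {gs = gs} w t (∧⇒L r d) with ∷-↭-∷ (trans (↭-sym t) r)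
inv ∧⇒⇝ t (∧⇒L r d) | inj₁ (refl , s) = exch (prep _ (↭-sym s)) d
inv {gs = gs} w t (∧⇒L r d) | inj₂ (_ , a , b) =
  ∧⇒L (under⁺ gs a) (exch (shift _ gs _) (inv w (under b) d))
inv {gs = gs} w t (∨⇒L r d) with ∷-↭-∷ (trans (↭-sym t) r)
inv ∨⇒⇝ t (∨⇒L r d) | inj₁ (refl , s) = exch (prep _ (prep _ (↭-sym s))) d
inv {gs = gs} w t (∨⇒L {φ = φ} {ψ} {χ} r d) | inj₂ (_ , a , b) =
  ∨⇒L (under⁺ gs a) (exch (shifts gs ((φ ⇒ χ) ∷ (ψ ⇒ χ) ∷ [])) (inv w (under⁺ (_ ∷ _ ∷ []) b) d))
inv {gs = gs} w t (p⇒L r d) with ∷-↭-∷ (trans (↭-sym t) r)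
inv () t (p⇒L r d) | inj₁ (refl , _)
inv {gs = gs} w t (p⇒L {p = p} {φ} r d) | inj₂ (_ , a , b) with ∷-↭-∷ (↭-sym b)
inv p⇒⇝ t (p⇒L r d) | inj₂ (_ , a , b) | inj₁ (refl , s) =
  exch (trans (swap _ _ (↭-sym s)) (prep _ (↭-sym a))) d
inv {gs = gs} w t (p⇒L {p = p} {φ} r d) | inj₂ (_ , a , b) | inj₂ (_ , a' , b') =
  p⇒L (trans (under⁺ gs a) (prep _ (under⁺ gs a')))
      (exch (shifts gs (var p ∷ φ ∷ [])) (inv w (under⁺ (_ ∷ _ ∷ []) b') d))
inv {gs = gs} w t (⇒⇒L r d e) with ∷-↭-∷ (trans (↭-sym t) r)
inv ⇒⇒⇝ t (⇒⇒L r d e) | inj₁ (refl , s) = exch (prep _ (↭-sym s)) e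
inv {gs = gs} w t (⇒⇒L r d e) | inj₂ (_ , a , b) =
  ⇒⇒L (under⁺ gs a) (exch (shift _ gs _) (inv w (under b) d)) (exch (shift _ gs _) (inv w (under b) e))
inv w t (□R d) = □R (wk (⇝-boxInv w t) d)
inv {gs = gs} w t (□⇒L r d e) with ∷-↭-∷ (trans (↭-sym t) r)
inv □⇒⇝ t (□⇒L r d e) | inj₁ (refl , s) = exch (prep _ (↭-sym s)) e
inv {gs = gs} w t (□⇒L r d e) | inj₂ (_ , a , b) =
  □⇒L (under⁺ gs a) (wk (⇝-boxInv w b) d) (exch (shift _ gs _) (inv w (under b) e))
inv {gs = gs} w t (◇⇒L r d e) with ∷-↭-∷ (trans (↭-sym t) r)
inv () t (◇⇒L r d e) | inj₁ (refl , _)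
inv {gs = gs} w t (◇⇒L {γ = γ} {φ} {ψ} r d e) | inj₂ (_ , a , b) with ∷-↭-∷ (↭-sym b)
inv ◇⇒⇝ t (◇⇒L r d e) | inj₂ (_ , a , b) | inj₁ (refl , s) =
  exch (trans (swap _ _ (↭-sym s)) (prep _ (↭-sym a))) e
inv {gs = gs} w t (◇⇒L {γ = γ} {φ} {ψ} r d e) | inj₂ (_ , a , b) | inj₂ (_ , a' , b') =
  ◇⇒L (trans (under⁺ gs a) (prep _ (under⁺ gs a')))
      (wk (⊑-prep (⇝-boxInv w b')) d)
      (exch (shifts gs (◇ γ ∷ ψ ∷ [])) (inv w (under⁺ (_ ∷ _ ∷ []) b') e))
inv {gs = gs} w t (◇L' r d) with ∷-↭-∷ (trans (↭-sym t) r)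
inv () t (◇L' r d) | inj₁ (refl , _)
inv {gs = gs} w t (◇L' r d) | inj₂ (_ , a , b) = ◇L' (under⁺ gs a) (wk (⊑-prep (⇝-boxInv w b)) d)

-- Admissibility of implication on the left.

diaInv-view : ∀ Δ → (∃ λ δ → Δ ≡ just (◇ δ)) ⊎ diaInv Δ ≡ nothing
diaInv-view nothing = inj₂ refl
diaInv-view (just (var _)) = inj₂ refl
diaInv-view (just ⊥') = inj₂ refl
diaInv-view (just (_ ∧' _)) = inj₂ refl
diaInv-view (just (_ ∨' _)) = inj₂ refl
diaInv-view (just (_ ⇒ _)) = inj₂ refl
diaInv-view (just (□ _)) = inj₂ refl
diaInv-view (just (◇ δ)) = inj₁ (δ , refl)

inv∷ : x ⇝ hs → Γ ↭ x ∷ Γ₀ → C ∷ Γ ⊢ Δ → C ∷ hs ++ Γ₀ ⊢ Δ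
inv∷ w r e = exch (shift _ _ _) (inv w (under r) e)

-- Induction on the first derivation. A right rule fixes the shape of `B` and thereby the left rule
-- for `B ⇒ C`; a left rule is repeated, after the second derivation has been inverted to the same
-- antecedent.
⇒L : Γ ⊢ just B → C ∷ Γ ⊢ Δ → (B ⇒ C) ∷ Γ ⊢ Δ
⇒L (⊥L r) e = ⊥L (under r)
⇒L (IdP r) e = p⇒L (under r) (exch (under r) e)
⇒L (∧L r d) e = ∧L (under r) (exch rot⁻¹ (⇒L d (inv∷ ∧⇝ r e)))
⇒L (∧R d d') e = ∧⇒L refl (⇒L d (⇒L d' e))
⇒L (∨L r d d') e = ∨L (under r) (exch (swap _ _ refl) (⇒L d (inv∷ ∨⇝₁ r e)))
                                (exch (swap _ _ refl) (⇒L d' (inv∷ ∨⇝₂ r e)))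
⇒L (∨R₁ d) e = ∨⇒L refl (exch (swap _ _ refl) (wk∷ (⇒L d e)))
⇒L (∨R₂ d) e = ∨⇒L refl (wk∷ (⇒L d e))
⇒L (⇒R d) e = ⇒⇒L refl (wk∷ (⇒R d)) e
⇒L (∧⇒L r d) e = ∧⇒L (under r) (exch (swap _ _ refl) (⇒L d (inv∷ ∧⇒⇝ r e)))
⇒L (∨⇒L r d) e =
  ∨⇒L (under r) (exch rot⁻¹ (⇒L d (inv∷ ∨⇒⇝ r e)))
⇒L (p⇒L r d) e =
  p⇒L (trans (under r) (prep _ (swap _ _ refl)))
      (exch rot⁻¹
            (⇒L d (exch (prep _ (swap _ _ refl)) (inv∷ p⇒⇝ (trans r (swap _ _ refl)) e))))
⇒L (⇒⇒L r d d') e =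
  ⇒⇒L (under r) (exch (swap _ _ refl) (wk∷ d)) (exch (swap _ _ refl) (⇒L d' (inv∷ ⇒⇒⇝ r e)))
⇒L (□R d) e = □⇒L refl d e
⇒L (□⇒L r d d') e = □⇒L (under r) d (exch (swap _ _ refl) (⇒L d' (inv∷ □⇒⇝ r e)))
⇒L (◇⇒L r d d') e =
  ◇⇒L (trans (under r) (prep _ (swap _ _ refl))) d
      (exch rot⁻¹
            (⇒L d' (exch (prep _ (swap _ _ refl)) (inv∷ ◇⇒⇝ (trans r (swap _ _ refl)) e))))
-- If `B` is `◇ δ`, the premise at hand is the first premise of `◇⇒L`. Otherwise its succedent is
-- empty, and `◇L'` yields any succedent.
⇒L {B = B} (◇L' r d) e with diaInv-view (just B)
... | inj₁ (δ , refl) = ◇⇒L (under r) d (exch (under r) e)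
... | inj₂ eq rewrite eq = ◇L' (under r) (rwk d)

p⇒L-∈ : ∀ {q φ} → var q ∈ Γ → φ ∷ Γ ⊢ Δ → (var q ⇒ φ) ∷ Γ ⊢ Δ
p⇒L-∈ i d with _ , r ← ∈⇒↭∷ i = p⇒L (under r) (exch (under r) d)

◇⇒L-∈ : ∀ {γ φ ψ} → ◇ γ ∈ Γ → γ ∷ boxInv Γ ⊢ just φ → ψ ∷ Γ ⊢ Δ → (◇ φ ⇒ ψ) ∷ Γ ⊢ Δ
◇⇒L-∈ i d e with _ , r ← ∈⇒↭∷ i = ◇⇒L (under r) (exch (prep _ (boxInv-↭ r)) d) (exch (under r) e)

-- Finite conjunctions and disjunctions.

⊤' : Form
⊤' = ⊥' ⇒ ⊥'

⊤R : Γ ⊢ just ⊤'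
⊤R = ⇒R (⊥L refl)

⋀ ⋁ : List Form → Form
⋀ = foldr _∧'_ ⊤'
⋁ = foldr _∨'_ ⊥'

⋀R : All (λ c → Γ ⊢ just c) gs → Γ ⊢ just (⋀ gs)
⋀R [] = ⊤R
⋀R (d ∷ ds) = ∧R d (⋀R ds)

⋀L : ∀ gs → Γ ++ gs ⊢ Δ → ⋀ gs ∷ Γ ⊢ Δ
⋀L {Γ = Γ} [] d = wk∷ (exch (++-identityʳ Γ) d)
⋀L {Γ = Γ} (x ∷ gs) d = ∧L refl (exch (swap _ _ refl) (⋀L {Γ = x ∷ Γ} gs (exch (shift x Γ gs) d)))

⋁L : All (λ c → c ∷ Γ ⊢ Δ) gs → ⋁ gs ∷ Γ ⊢ Δ
⋁L [] = ⊥L refl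
⋁L (d ∷ ds) = ∨L refl d (⋁L ds)

⋁R : x ∈ gs → Γ ⊢ just x → Γ ⊢ just (⋁ gs)
⋁R (here refl) d = ∨R₁ d
⋁R (there i) d = ∨R₂ (⋁R i d)

-- Occurrences of formulas, atoms and diamonds in an antecedent.

picks : List Form → List (Form × List Form)
picks [] = []
picks (x ∷ Γ) = (x , Γ) ∷ map (λ (y , Γ₀) → y , x ∷ Γ₀) (picks Γ)

∈-picks⁻ : (x , Γ₀) ∈ picks Γ → Γ ↭ x ∷ Γ₀
∈-picks⁻ {Γ = _ ∷ _} (here refl) = refl
∈-picks⁻ {Γ = _ ∷ _} (there i) with _ , j , refl ← ∈-map⁻ _ i = under (∈-picks⁻ j)

∈-picks⁺ : x ∈ Γ → ∃ λ Γ₀ → (x , Γ₀) ∈ picks Γ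
∈-picks⁺ (here refl) = _ , here refl
∈-picks⁺ (there i) with _ , j ← ∈-picks⁺ i = _ , there (∈-map⁺ _ j)

-- For the rules with two principal formulas: the atom or diamond is located first, but the clause
-- belongs to the implication and must be indexed by it.
picks-swap : ∀ {Γ₁} → (y , Γ₀) ∈ picks Γ → (x , Γ₁) ∈ picks Γ₀ →
             ∃ λ Γ₂ → (x , Γ₂) ∈ picks Γ × Γ₂ ↭ y ∷ Γ₁
picks-swap i j with Γ₂ , k ← ∈-picks⁺ (∈-resp-↭ (↭-sym (∈-picks⁻ i))
                                         (there (∈-resp-↭ (↭-sym (∈-picks⁻ j)) (here refl)))) =
  Γ₂ , k , drop-∷ (trans (↭-sym (∈-picks⁻ k)) (trans (∈-picks⁻ i) (under (∈-picks⁻ j))))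

unvar : Form → Maybe Var
unvar (var q) = just q
unvar _ = nothing

-- Collected as variables, so that membership is decidable without deciding equality of formulas.
atoms : List Form → List Var
atoms = mapMaybe unvar

∈-atoms⁻ : ∀ {q} Γ → q ∈ atoms Γ → var q ∈ Γ
∈-atoms⁻ (var _ ∷ Γ) (here refl) = here refl
∈-atoms⁻ (var _ ∷ Γ) (there i) = there (∈-atoms⁻ Γ i)
∈-atoms⁻ (⊥' ∷ Γ) i = there (∈-atoms⁻ Γ i)
∈-atoms⁻ ((_ ∧' _) ∷ Γ) i = there (∈-atoms⁻ Γ i)
∈-atoms⁻ ((_ ∨' _) ∷ Γ) i = there (∈-atoms⁻ Γ i)
∈-atoms⁻ ((_ ⇒ _) ∷ Γ) i = there (∈-atoms⁻ Γ i)
∈-atoms⁻ (□ _ ∷ Γ) i = there (∈-atoms⁻ Γ i)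
∈-atoms⁻ (◇ _ ∷ Γ) i = there (∈-atoms⁻ Γ i)

undia : Form → Maybe Form
undia (◇ φ) = just φ
undia _ = nothing

diamonds : List Form → List Form
diamonds = mapMaybe undia

∈-diamonds⁻ : ∀ Γ → x ∈ diamonds Γ → ◇ x ∈ Γ
∈-diamonds⁻ (var _ ∷ Γ) i = there (∈-diamonds⁻ Γ i)
∈-diamonds⁻ (⊥' ∷ Γ) i = there (∈-diamonds⁻ Γ i)
∈-diamonds⁻ ((_ ∧' _) ∷ Γ) i = there (∈-diamonds⁻ Γ i)
∈-diamonds⁻ ((_ ∨' _) ∷ Γ) i = there (∈-diamonds⁻ Γ i)
∈-diamonds⁻ ((_ ⇒ _) ∷ Γ) i = there (∈-diamonds⁻ Γ i)
∈-diamonds⁻ (□ _ ∷ Γ) i = there (∈-diamonds⁻ Γ i)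
∈-diamonds⁻ (◇ _ ∷ Γ) (here refl) = here refl
∈-diamonds⁻ (◇ _ ∷ Γ) (there i) = there (∈-diamonds⁻ Γ i)

VarsIn : (Var → Set) → Form → Set
VarsIn U φ = ∀ q → Occ q φ → U q

boxInv-VarsIn : ∀ {U} → All (VarsIn U) Γ → All (VarsIn U) (boxInv Γ)
boxInv-VarsIn {Γ = []} [] = []
boxInv-VarsIn {Γ = var _ ∷ _} (u ∷ us) = boxInv-VarsIn us
boxInv-VarsIn {Γ = ⊥' ∷ _} (u ∷ us) = boxInv-VarsIn us
boxInv-VarsIn {Γ = (_ ∧' _) ∷ _} (u ∷ us) = boxInv-VarsIn us
boxInv-VarsIn {Γ = (_ ∨' _) ∷ _} (u ∷ us) = boxInv-VarsIn us
boxInv-VarsIn {Γ = (_ ⇒ _) ∷ _} (u ∷ us) = boxInv-VarsIn us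
boxInv-VarsIn {Γ = □ _ ∷ _} (u ∷ us) = (λ q → u q ∘ □o) ∷ boxInv-VarsIn us
boxInv-VarsIn {Γ = ◇ _ ∷ _} (u ∷ us) = boxInv-VarsIn us

when : {X : Set} → Dec X → List Form → List Form
when (yes _) gs = gs
when (no _) gs = []

All-when : {X : Set} {P : Form → Set} (d : Dec X) → (X → All P gs) → All P (when d gs)
All-when (yes a) h = h a
All-when (no _) h = []

∈-when : {X : Set} (d : Dec X) → X → x ∈ gs → x ∈ when d gs
∈-when (yes _) a i = i
∈-when (no ¬a) a i = ⊥-elim (¬a a)

-- The clauses of E and A.

-- The clauses defining E_p and A_p, relative to their values e and a at smaller sequents: eL and aL
-- belong to a left rule with principal formula in Γ, aR to a right rule; the boxed conjunct of
-- conjuncts and the diamond disjunct of disjuncts belong to a modal rule all of whose principal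
-- formulas lie in Π.
module Clauses (p : Var) (e : List Form → Form) (a : List Form → Maybe Form → Form) where

  ea : List Form → Maybe Form → Form
  ea Γ Δ = e Γ ⇒ a Γ Δ

  eL : Form → List Form → List Form
  eL (var q) Γ = when (¬? (q ≟ p)) (var q ∷ [])
  eL ⊥' Γ = ⊥' ∷ []
  eL (φ ∧' ψ) Γ = e (φ ∷ ψ ∷ Γ) ∷ []
  eL (φ ∨' ψ) Γ = (e (φ ∷ Γ) ∨' e (ψ ∷ Γ)) ∷ []
  -- The matching atom lies in the unknown context, which excludes `q ≡ p`, or in `Γ` itself.
  eL (var q ⇒ φ) Γ = when (¬? (q ≟ p)) ((var q ⇒ e (φ ∷ Γ)) ∷ [])
                  ++ when (q ∈? atoms Γ) (e (φ ∷ Γ) ∷ [])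
  -- No left rule has such an implication as its principal formula.
  eL (⊥' ⇒ φ) Γ = []
  eL ((φ ∧' ψ) ⇒ χ) Γ = e ((φ ⇒ (ψ ⇒ χ)) ∷ Γ) ∷ []
  eL ((φ ∨' ψ) ⇒ χ) Γ = e ((φ ⇒ χ) ∷ (ψ ⇒ χ) ∷ Γ) ∷ []
  eL ((φ ⇒ ψ) ⇒ χ) Γ = (ea ((ψ ⇒ χ) ∷ Γ) (just (φ ⇒ ψ)) ⇒ e (χ ∷ Γ)) ∷ []
  eL (□ φ ⇒ ψ) Γ = (□ (ea (boxInv Γ) (just φ)) ⇒ e (ψ ∷ Γ)) ∷ []
  eL (◇ φ ⇒ ψ) Γ = (◇ (ea (boxInv Γ) (just φ)) ⇒ e (ψ ∷ Γ))
                 ∷ map (λ γ → □ (ea (γ ∷ boxInv Γ) (just φ)) ⇒ e (ψ ∷ Γ)) (diamonds Γ)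
  -- Boxes are never principal on the left; the modal clauses see them through `boxInv`.
  eL (□ φ) Γ = []
  eL (◇ φ) Γ = ◇ (e (φ ∷ boxInv Γ)) ∷ []

  conjuncts : List Form → List Form
  conjuncts Γ = □ (e (boxInv Γ)) ∷ concatMap (λ (x , Γ₀) → eL x Γ₀) (picks Γ)

  aId : Var → Maybe Form → List Form
  aId q (just (var r)) = when (q ≟ r) (⊤' ∷ [])
  aId q _ = []

  aL : Form → List Form → Maybe Form → List Form
  aL (var q) Γ Δ = aId q Δ
  -- This case is closed by the conjunct `⊥'` of E, which proves every succedent.
  aL ⊥' Γ Δ = []
  aL (φ ∧' ψ) Γ Δ = a (φ ∷ ψ ∷ Γ) Δ ∷ []
  -- E of the conclusion supplies only the disjunction of the two premise values of E, so each A
  -- carries its own E as hypothesis although `Δ` is unchanged.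
  aL (φ ∨' ψ) Γ Δ = (ea (φ ∷ Γ) Δ ∧' ea (ψ ∷ Γ) Δ) ∷ []
  aL (var q ⇒ φ) Γ Δ = when (¬? (q ≟ p)) ((var q ∧' a (φ ∷ Γ) Δ) ∷ [])
                    ++ when (q ∈? atoms Γ) (a (φ ∷ Γ) Δ ∷ [])
  aL (⊥' ⇒ φ) Γ Δ = []
  aL ((φ ∧' ψ) ⇒ χ) Γ Δ = a ((φ ⇒ (ψ ⇒ χ)) ∷ Γ) Δ ∷ []
  aL ((φ ∨' ψ) ⇒ χ) Γ Δ = a ((φ ⇒ χ) ∷ (ψ ⇒ χ) ∷ Γ) Δ ∷ []
  aL ((φ ⇒ ψ) ⇒ χ) Γ Δ = (ea ((ψ ⇒ χ) ∷ Γ) (just (φ ⇒ ψ)) ∧' a (χ ∷ Γ) Δ) ∷ []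
  aL (□ φ ⇒ ψ) Γ Δ = (□ (ea (boxInv Γ) (just φ)) ∧' a (ψ ∷ Γ) Δ) ∷ []
  aL (◇ φ ⇒ ψ) Γ Δ = (◇ (ea (boxInv Γ) (just φ)) ∧' a (ψ ∷ Γ) Δ)
                   ∷ map (λ γ → □ (ea (γ ∷ boxInv Γ) (just φ)) ∧' a (ψ ∷ Γ) Δ) (diamonds Γ)
  aL (□ φ) Γ Δ = []
  aL (◇ φ) Γ Δ = □ (ea (φ ∷ boxInv Γ) (diaInv Δ)) ∷ []

  aR : List Form → Maybe Form → List Form
  aR Γ nothing = []
  aR Γ (just (var q)) = when (¬? (q ≟ p)) (var q ∷ [])
  aR Γ (just ⊥') = []
  aR Γ (just (φ ∧' ψ)) = (a Γ (just φ) ∧' a Γ (just ψ)) ∷ []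
  aR Γ (just (φ ∨' ψ)) = a Γ (just φ) ∷ a Γ (just ψ) ∷ []
  aR Γ (just (φ ⇒ ψ)) = ea (φ ∷ Γ) (just ψ) ∷ []
  aR Γ (just (□ φ)) = □ (ea (boxInv Γ) (just φ)) ∷ []
  -- A diamond on the right arises only from `◇L'`, which is treated by the diamond disjunct of
  -- `disjuncts` and by `aL`.
  aR Γ (just (◇ φ)) = []

  disjuncts : List Form → Maybe Form → List Form
  disjuncts Γ Δ = ◇ (ea (boxInv Γ) (diaInv Δ)) ∷ aR Γ Δ ++ concatMap (λ (x , Γ₀) → aL x Γ₀ Δ) (picks Γ)

  All-eL : {P : Form → Set} → (∀ x Γ₀ → (x , Γ₀) ∈ picks Γ → All P (eL x Γ₀)) →
           All P (concatMap (λ (x , Γ₀) → eL x Γ₀) (picks Γ))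
  All-eL h = concat⁺ (map⁺ (All.tabulate (h _ _)))

  All-aL : {P : Form → Set} → (∀ x Γ₀ → (x , Γ₀) ∈ picks Γ → All P (aL x Γ₀ Δ)) →
           All P (concatMap (λ (x , Γ₀) → aL x Γ₀ Δ) (picks Γ))
  All-aL h = concat⁺ (map⁺ (All.tabulate (h _ _)))

  -- Soundness of the clauses.

  module Sound (e-sound : ∀ Γ → Γ ⊢ just (e Γ)) (a-sound : ∀ Γ Δ → a Γ Δ ∷ Γ ⊢ Δ) where

    -- Needs the admissible rule, since `e Γ` is an arbitrary formula and no single left rule of the
    -- calculus introduces this implication.
    ea-sound : ∀ Γ Δ → ea Γ Δ ∷ Γ ⊢ Δ
    ea-sound Γ Δ = ⇒L (e-sound Γ) (a-sound Γ Δ)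

    e-wk : ∀ x y Γ → x ∷ y ∷ Γ ⊢ just (e (x ∷ Γ))
    e-wk x y Γ = exch (swap _ _ refl) (wk∷ (e-sound (x ∷ Γ)))

    eL-sound : ∀ x Γ → All (λ c → x ∷ Γ ⊢ just c) (eL x Γ)
    eL-sound (var q) Γ = All-when (¬? (q ≟ p)) λ _ → IdP refl ∷ []
    eL-sound ⊥' Γ = ⊥L refl ∷ []
    eL-sound (φ ∧' ψ) Γ = ∧L refl (e-sound _) ∷ []
    eL-sound (φ ∨' ψ) Γ = ∨L refl (∨R₁ (e-sound _)) (∨R₂ (e-sound _)) ∷ []
    eL-sound (var q ⇒ φ) Γ =
      ++⁺ (All-when (¬? (q ≟ p)) λ _ → ⇒R (p⇒L refl (wk∷ (e-sound _))) ∷ [])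
          (All-when (q ∈? atoms Γ) λ i → p⇒L-∈ (∈-atoms⁻ Γ i) (e-sound _) ∷ [])
    eL-sound (⊥' ⇒ φ) Γ = []
    eL-sound ((φ ∧' ψ) ⇒ χ) Γ = ∧⇒L refl (e-sound _) ∷ []
    eL-sound ((φ ∨' ψ) ⇒ χ) Γ = ∨⇒L refl (e-sound _) ∷ []
    eL-sound ((φ ⇒ ψ) ⇒ χ) Γ =
      ⇒R (⇒⇒L (swap _ _ refl) (exch (swap _ _ refl) (ea-sound _ _)) (e-wk _ _ _)) ∷ []
    eL-sound (□ φ ⇒ ψ) Γ = ⇒R (□⇒L (swap _ _ refl) (ea-sound _ _) (e-wk _ _ _)) ∷ []
    eL-sound (◇ φ ⇒ ψ) Γ = ⇒R (◇⇒L refl (ea-sound _ _) (wk∷ (e-sound _))) ∷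
      map⁺ (All.tabulate λ i → ⇒R (exch (swap _ _ refl) (◇⇒L-∈ (there (∈-diamonds⁻ Γ i))
        (exch (swap _ _ refl) (ea-sound _ _)) (e-wk _ _ _))))
    eL-sound (□ φ) Γ = []
    eL-sound (◇ φ) Γ = ◇L' refl (e-sound _) ∷ []

    conjuncts-sound : ∀ Γ → Γ ⊢ just (⋀ (conjuncts Γ))
    conjuncts-sound Γ = ⋀R (□R (e-sound _) ∷
      All-eL λ x Γ₀ i → All.map (exch (↭-sym (∈-picks⁻ i))) (eL-sound x Γ₀))

    a-wk : ∀ x Γ → x ∷ y ∷ a (x ∷ Γ) Δ ∷ Γ ⊢ Δ
    a-wk x Γ = exch (swap _ _ refl) (wk∷ (exch (swap _ _ refl) (a-sound _ _)))

    ea-wk-boxInv : ∀ x Γ Δ → ea (boxInv Γ) Δ ∷ boxInv (x ∷ Γ) ⊢ Δ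
    ea-wk-boxInv x Γ Δ = wk (⊑-prep (⊑-boxInv (⊑-drop {Γ = Γ} (x ∷ [])))) (ea-sound _ Δ)

    ea-wk-boxInv∷ : ∀ z x Γ Δ → z ∷ ea (z ∷ boxInv Γ) Δ ∷ boxInv (x ∷ Γ) ⊢ Δ
    ea-wk-boxInv∷ z x Γ Δ =
      wk (⊑-prep (⊑-prep (⊑-boxInv (⊑-drop {Γ = Γ} (x ∷ []))))) (exch (swap _ _ refl) (ea-sound _ Δ))

    aId-sound : ∀ q Γ Δ → All (λ d → d ∷ var q ∷ Γ ⊢ Δ) (aId q Δ)
    aId-sound q Γ (just (var r)) = All-when (q ≟ r) λ { refl → IdP (swap _ _ refl) ∷ [] }
    aId-sound q Γ nothing = []
    aId-sound q Γ (just ⊥') = []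
    aId-sound q Γ (just (_ ∧' _)) = []
    aId-sound q Γ (just (_ ∨' _)) = []
    aId-sound q Γ (just (_ ⇒ _)) = []
    aId-sound q Γ (just (□ _)) = []
    aId-sound q Γ (just (◇ _)) = []

    aL-sound : ∀ x Γ Δ → All (λ d → d ∷ x ∷ Γ ⊢ Δ) (aL x Γ Δ)
    aL-sound (var q) Γ Δ = aId-sound q Γ Δ
    aL-sound ⊥' Γ Δ = []
    aL-sound (φ ∧' ψ) Γ Δ = ∧L (swap _ _ refl) (exch rot⁻¹ (a-sound _ _)) ∷ []
    aL-sound (φ ∨' ψ) Γ Δ =
      ∧L refl (∨L rot (exch rot⁻¹ (wk∷ (exch (swap _ _ refl) (ea-sound _ _))))
                      (exch (swap _ _ refl) (wk∷ (exch (swap _ _ refl) (ea-sound _ _))))) ∷ []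
    aL-sound (var q ⇒ φ) Γ Δ =
      ++⁺ (All-when (¬? (q ≟ p)) λ _ → ∧L refl (exch rot⁻¹ (p⇒L-∈ (here refl) (a-wk _ _))) ∷ [])
          (All-when (q ∈? atoms Γ) λ i →
             exch (swap _ _ refl) (p⇒L-∈ (there (∈-atoms⁻ Γ i)) (exch (swap _ _ refl) (a-sound _ _))) ∷ [])
    aL-sound (⊥' ⇒ φ) Γ Δ = []
    aL-sound ((φ ∧' ψ) ⇒ χ) Γ Δ = ∧⇒L (swap _ _ refl) (exch (swap _ _ refl) (a-sound _ _)) ∷ []
    aL-sound ((φ ∨' ψ) ⇒ χ) Γ Δ =
      ∨⇒L (swap _ _ refl) (exch rot⁻¹ (a-sound _ _)) ∷ []
    aL-sound ((φ ⇒ ψ) ⇒ χ) Γ Δ =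
      ∧L refl (⇒⇒L rot (exch rot⁻¹ (wk∷ (exch (swap _ _ refl) (ea-sound _ _)))) (a-wk _ _)) ∷ []
    aL-sound (□ φ ⇒ ψ) Γ Δ = ∧L refl (□⇒L rot (ea-wk-boxInv (a (ψ ∷ Γ) Δ) Γ _) (a-wk _ _)) ∷ []
    aL-sound (◇ φ ⇒ ψ) Γ Δ =
      ∧L refl (◇⇒L (prep _ (swap _ _ refl)) (ea-wk-boxInv (a (ψ ∷ Γ) Δ) Γ _) (exch (swap _ _ refl) (a-wk _ _))) ∷
      map⁺ (All.tabulate λ i → ∧L refl
        (exch rot⁻¹ (◇⇒L-∈ (there (there (∈-diamonds⁻ Γ i))) (ea-wk-boxInv∷ _ (a (ψ ∷ Γ) Δ) Γ _) (a-wk _ _))))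
    aL-sound (□ φ) Γ Δ = []
    aL-sound (◇ φ) Γ Δ = ◇L' (swap _ _ refl) (exch (swap _ _ refl) (ea-sound _ _)) ∷ []

    aR-sound : ∀ Γ Δ → All (λ d → d ∷ Γ ⊢ Δ) (aR Γ Δ)
    aR-sound Γ nothing = []
    aR-sound Γ (just (var q)) = All-when (¬? (q ≟ p)) λ _ → IdP refl ∷ []
    aR-sound Γ (just ⊥') = []
    aR-sound Γ (just (φ ∧' ψ)) =
      ∧L refl (∧R (exch (swap _ _ refl) (wk∷ (a-sound _ _))) (wk∷ (a-sound _ _))) ∷ []
    aR-sound Γ (just (φ ∨' ψ)) = ∨R₁ (a-sound _ _) ∷ ∨R₂ (a-sound _ _) ∷ []
    aR-sound Γ (just (φ ⇒ ψ)) = ⇒R (exch (swap _ _ refl) (ea-sound _ _)) ∷ []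
    aR-sound Γ (just (□ φ)) = □R (ea-sound _ _) ∷ []
    aR-sound Γ (just (◇ φ)) = []

    disjuncts-sound : ∀ Γ Δ → ⋁ (disjuncts Γ Δ) ∷ Γ ⊢ Δ
    disjuncts-sound Γ Δ = ⋁L (◇L' refl (ea-sound _ _) ∷ ++⁺ (aR-sound Γ Δ)
      (All-aL λ x Γ₀ i → All.map (exch (prep _ (↭-sym (∈-picks⁻ i)))) (aL-sound x Γ₀ Δ)))

  -- The variables of the clauses.

  Within : (Var → Set) → Form → Set
  Within U φ = ∀ q → Occ q φ → U q × ¬ q ≡ p

  module Free {U : Var → Set}
    (e-free : ∀ Γ → All (VarsIn U) Γ → Within U (e Γ))
    (a-free : ∀ Γ Δ → All (VarsIn U) Γ → (∀ q → OccM q Δ → U q) → Within U (a Γ Δ)) where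

    ∧-free : ∀ {φ ψ} → Within U φ → Within U ψ → Within U (φ ∧' ψ)
    ∧-free d e q (∧l o) = d q o
    ∧-free d e q (∧r o) = e q o

    ⇒-free : ∀ {φ ψ} → Within U φ → Within U ψ → Within U (φ ⇒ ψ)
    ⇒-free d e q (⇒l o) = d q o
    ⇒-free d e q (⇒r o) = e q o

    □-free : ∀ {φ} → Within U φ → Within U (□ φ)
    □-free d q (□o o) = d q o

    ◇-free : ∀ {φ} → Within U φ → Within U (◇ φ)
    ◇-free d q (◇o o) = d q o

    var-free : ∀ {q} → VarsIn U (var q) → ¬ q ≡ p → Within U (var q)
    var-free u q≢p q here = u q here , q≢p

    ⊤-free : Within U ⊤'
    ⊤-free q (⇒l ())
    ⊤-free q (⇒r ())

    ⋀-free : All (Within U) gs → Within U (⋀ gs)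
    ⋀-free [] = ⊤-free
    ⋀-free (d ∷ ds) = ∧-free d (⋀-free ds)

    ⋁-free : All (Within U) gs → Within U (⋁ gs)
    ⋁-free (d ∷ ds) q (∨l o) = d q o
    ⋁-free (d ∷ ds) q (∨r o) = ⋁-free ds q o

    ea-free : ∀ Γ Δ → All (VarsIn U) Γ → (∀ q → OccM q Δ → U q) → Within U (ea Γ Δ)
    ea-free Γ Δ u v = ⇒-free (e-free Γ u) (a-free Γ Δ u v)

    eL-free : ∀ x Γ → VarsIn U x → All (VarsIn U) Γ → All (Within U) (eL x Γ)
    eL-free (var q) Γ u us = All-when (¬? (q ≟ p)) λ q≢p → var-free u q≢p ∷ []
    eL-free ⊥' Γ u us = (λ _ ()) ∷ []
    eL-free (φ ∧' ψ) Γ u us = e-free _ ((λ q → u q ∘ ∧l) ∷ (λ q → u q ∘ ∧r) ∷ us) ∷ []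
    eL-free (φ ∨' ψ) Γ u us =
      (λ { q (∨l o) → e-free _ ((λ q → u q ∘ ∨l) ∷ us) q o
         ; q (∨r o) → e-free _ ((λ q → u q ∘ ∨r) ∷ us) q o }) ∷ []
    eL-free (var q ⇒ φ) Γ u us =
      ++⁺ (All-when (¬? (q ≟ p)) λ q≢p →
             ⇒-free (var-free (λ q → u q ∘ ⇒l) q≢p) (e-free _ ((λ q → u q ∘ ⇒r) ∷ us)) ∷ [])
          (All-when (q ∈? atoms Γ) λ _ → e-free _ ((λ q → u q ∘ ⇒r) ∷ us) ∷ [])
    eL-free (⊥' ⇒ φ) Γ u us = []
    eL-free ((φ ∧' ψ) ⇒ χ) Γ u us =
      e-free _ ((λ { q (⇒l o) → u q (⇒l (∧l o))
                   ; q (⇒r (⇒l o)) → u q (⇒l (∧r o))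
                   ; q (⇒r (⇒r o)) → u q (⇒r o) }) ∷ us) ∷ []
    eL-free ((φ ∨' ψ) ⇒ χ) Γ u us =
      e-free _ ((λ { q (⇒l o) → u q (⇒l (∨l o)) ; q (⇒r o) → u q (⇒r o) }) ∷
                (λ { q (⇒l o) → u q (⇒l (∨r o)) ; q (⇒r o) → u q (⇒r o) }) ∷ us) ∷ []
    eL-free ((φ ⇒ ψ) ⇒ χ) Γ u us =
      ⇒-free (ea-free _ _ ((λ { q (⇒l o) → u q (⇒l (⇒r o)) ; q (⇒r o) → u q (⇒r o) }) ∷ us)
                          (λ q → u q ∘ ⇒l))
             (e-free _ ((λ q → u q ∘ ⇒r) ∷ us)) ∷ []
    eL-free (□ φ ⇒ ψ) Γ u us =
      ⇒-free (□-free (ea-free _ _ (boxInv-VarsIn us) (λ q → u q ∘ ⇒l ∘ □o)))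
             (e-free _ ((λ q → u q ∘ ⇒r) ∷ us)) ∷ []
    eL-free (◇ φ ⇒ ψ) Γ u us =
      ⇒-free (◇-free (ea-free _ _ (boxInv-VarsIn us) (λ q → u q ∘ ⇒l ∘ ◇o)))
             (e-free _ ((λ q → u q ∘ ⇒r) ∷ us)) ∷
      map⁺ (All.tabulate λ i →
        ⇒-free (□-free (ea-free _ _ ((λ q → All.lookup us (∈-diamonds⁻ Γ i) q ∘ ◇o) ∷ boxInv-VarsIn us)
                                    (λ q → u q ∘ ⇒l ∘ ◇o)))
               (e-free _ ((λ q → u q ∘ ⇒r) ∷ us)))
    eL-free (□ φ) Γ u us = []
    eL-free (◇ φ) Γ u us = ◇-free (e-free _ ((λ q → u q ∘ ◇o) ∷ boxInv-VarsIn us)) ∷ []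

    conjuncts-free : ∀ Γ → All (VarsIn U) Γ → Within U (⋀ (conjuncts Γ))
    conjuncts-free Γ us = ⋀-free (□-free (e-free _ (boxInv-VarsIn us)) ∷
      All-eL λ x Γ₀ i → case All-resp-↭ (∈-picks⁻ i) us of λ { (v ∷ vs) → eL-free x Γ₀ v vs })

    aId-free : ∀ q Δ → All (Within U) (aId q Δ)
    aId-free q (just (var r)) = All-when (q ≟ r) λ _ → ⊤-free ∷ []
    aId-free q nothing = []
    aId-free q (just ⊥') = []
    aId-free q (just (_ ∧' _)) = []
    aId-free q (just (_ ∨' _)) = []
    aId-free q (just (_ ⇒ _)) = []
    aId-free q (just (□ _)) = []
    aId-free q (just (◇ _)) = []

    diaInv-VarsIn : ∀ Δ → (∀ q → OccM q Δ → U q) → ∀ q → OccM q (diaInv Δ) → U q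
    diaInv-VarsIn Δ v q o with diaInv-view Δ
    ... | inj₁ (δ , refl) = v q (◇o o)
    ... | inj₂ eq rewrite eq = ⊥-elim o

    aL-free : ∀ x Γ Δ → VarsIn U x → All (VarsIn U) Γ → (∀ q → OccM q Δ → U q) → All (Within U) (aL x Γ Δ)
    aL-free (var q) Γ Δ u us v = aId-free q Δ
    aL-free ⊥' Γ Δ u us v = []
    aL-free (φ ∧' ψ) Γ Δ u us v = a-free _ _ ((λ q → u q ∘ ∧l) ∷ (λ q → u q ∘ ∧r) ∷ us) v ∷ []
    aL-free (φ ∨' ψ) Γ Δ u us v =
      ∧-free (ea-free _ _ ((λ q → u q ∘ ∨l) ∷ us) v) (ea-free _ _ ((λ q → u q ∘ ∨r) ∷ us) v) ∷ []
    aL-free (var q ⇒ φ) Γ Δ u us v =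
      ++⁺ (All-when (¬? (q ≟ p)) λ q≢p →
             ∧-free (var-free (λ q → u q ∘ ⇒l) q≢p) (a-free _ _ ((λ q → u q ∘ ⇒r) ∷ us) v) ∷ [])
          (All-when (q ∈? atoms Γ) λ _ → a-free _ _ ((λ q → u q ∘ ⇒r) ∷ us) v ∷ [])
    aL-free (⊥' ⇒ φ) Γ Δ u us v = []
    aL-free ((φ ∧' ψ) ⇒ χ) Γ Δ u us v =
      a-free _ _ ((λ { q (⇒l o) → u q (⇒l (∧l o))
                     ; q (⇒r (⇒l o)) → u q (⇒l (∧r o))
                     ; q (⇒r (⇒r o)) → u q (⇒r o) }) ∷ us) v ∷ []
    aL-free ((φ ∨' ψ) ⇒ χ) Γ Δ u us v =
      a-free _ _ ((λ { q (⇒l o) → u q (⇒l (∨l o)) ; q (⇒r o) → u q (⇒r o) }) ∷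
                  (λ { q (⇒l o) → u q (⇒l (∨r o)) ; q (⇒r o) → u q (⇒r o) }) ∷ us) v ∷ []
    aL-free ((φ ⇒ ψ) ⇒ χ) Γ Δ u us v =
      ∧-free (ea-free _ _ ((λ { q (⇒l o) → u q (⇒l (⇒r o)) ; q (⇒r o) → u q (⇒r o) }) ∷ us)
                          (λ q → u q ∘ ⇒l))
             (a-free _ _ ((λ q → u q ∘ ⇒r) ∷ us) v) ∷ []
    aL-free (□ φ ⇒ ψ) Γ Δ u us v =
      ∧-free (□-free (ea-free _ _ (boxInv-VarsIn us) (λ q → u q ∘ ⇒l ∘ □o)))
             (a-free _ _ ((λ q → u q ∘ ⇒r) ∷ us) v) ∷ []
    aL-free (◇ φ ⇒ ψ) Γ Δ u us v =
      ∧-free (◇-free (ea-free _ _ (boxInv-VarsIn us) (λ q → u q ∘ ⇒l ∘ ◇o)))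
             (a-free _ _ ((λ q → u q ∘ ⇒r) ∷ us) v) ∷
      map⁺ (All.tabulate λ i →
        ∧-free (□-free (ea-free _ _ ((λ q → All.lookup us (∈-diamonds⁻ Γ i) q ∘ ◇o) ∷ boxInv-VarsIn us)
                                    (λ q → u q ∘ ⇒l ∘ ◇o)))
               (a-free _ _ ((λ q → u q ∘ ⇒r) ∷ us) v))
    aL-free (□ φ) Γ Δ u us v = []
    aL-free (◇ φ) Γ Δ u us v =
      □-free (ea-free _ _ ((λ q → u q ∘ ◇o) ∷ boxInv-VarsIn us) (diaInv-VarsIn Δ v)) ∷ []

    aR-free : ∀ Γ Δ → All (VarsIn U) Γ → (∀ q → OccM q Δ → U q) → All (Within U) (aR Γ Δ)
    aR-free Γ nothing us v = []
    aR-free Γ (just (var q)) us v = All-when (¬? (q ≟ p)) λ q≢p → var-free v q≢p ∷ []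
    aR-free Γ (just ⊥') us v = []
    aR-free Γ (just (φ ∧' ψ)) us v =
      ∧-free (a-free _ _ us (λ q → v q ∘ ∧l)) (a-free _ _ us (λ q → v q ∘ ∧r)) ∷ []
    aR-free Γ (just (φ ∨' ψ)) us v =
      a-free _ _ us (λ q → v q ∘ ∨l) ∷ a-free _ _ us (λ q → v q ∘ ∨r) ∷ []
    aR-free Γ (just (φ ⇒ ψ)) us v = ea-free _ _ ((λ q → v q ∘ ⇒l) ∷ us) (λ q → v q ∘ ⇒r) ∷ []
    aR-free Γ (just (□ φ)) us v = □-free (ea-free _ _ (boxInv-VarsIn us) (λ q → v q ∘ □o)) ∷ []
    aR-free Γ (just (◇ φ)) us v = []

    disjuncts-free : ∀ Γ Δ → All (VarsIn U) Γ → (∀ q → OccM q Δ → U q) → Within U (⋁ (disjuncts Γ Δ))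
    disjuncts-free Γ Δ us v = ⋁-free
      (◇-free (ea-free _ _ (boxInv-VarsIn us) (diaInv-VarsIn Δ v)) ∷ ++⁺ (aR-free Γ Δ us v)
      (All-aL λ x Γ₀ i → case All-resp-↭ (∈-picks⁻ i) us of λ { (w ∷ ws) → aL-free x Γ₀ Δ w ws v }))

-- E and A by recursion on fuel.

mutual
  EL : Var → ℕ → List Form → List Form
  EL p zero Γ = []
  EL p (suc n) Γ = Clauses.conjuncts p (E' p n) (A' p n) Γ

  AL : Var → ℕ → List Form → Maybe Form → List Form
  AL p zero Γ Δ = []
  AL p (suc n) Γ Δ = Clauses.disjuncts p (E' p n) (A' p n) Γ Δ

  -- The number is fuel: clauses beyond that recursion depth are replaced by the empty conjunction
  -- or disjunction, which keeps p-freeness and the implications; only uniformity needs enough fuel.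
  E' : Var → ℕ → List Form → Form
  E' p n Γ = ⋀ (EL p n Γ)

  A' : Var → ℕ → List Form → Maybe Form → Form
  A' p n Γ Δ = ⋁ (AL p n Γ Δ)

mutual
  E'-sound : ∀ p n Γ → Γ ⊢ just (E' p n Γ)
  E'-sound p zero Γ = ⊤R
  E'-sound p (suc n) Γ = Clauses.Sound.conjuncts-sound p _ _ (E'-sound p n) (A'-sound p n) Γ

  A'-sound : ∀ p n Γ Δ → A' p n Γ Δ ∷ Γ ⊢ Δ
  A'-sound p zero Γ Δ = ⊥L refl
  A'-sound p (suc n) Γ Δ = Clauses.Sound.disjuncts-sound p _ _ (E'-sound p n) (A'-sound p n) Γ Δ

module _ (p : Var) {U : Var → Set} where mutual
  E'-free : ∀ n Γ → All (VarsIn U) Γ → ∀ q → Occ q (E' p n Γ) → U q × ¬ q ≡ p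
  E'-free zero Γ us q (⇒l ())
  E'-free zero Γ us q (⇒r ())
  E'-free (suc n) Γ us = Clauses.Free.conjuncts-free p _ _ (E'-free n) (A'-free n) Γ us

  A'-free : ∀ n Γ Δ → All (VarsIn U) Γ → (∀ q → OccM q Δ → U q) →
            ∀ q → Occ q (A' p n Γ Δ) → U q × ¬ q ≡ p
  A'-free (suc n) Γ Δ us v = Clauses.Free.disjuncts-free p _ _ (E'-free n) (A'-free n) Γ Δ us v

-- A numerical measure of sequents.

-- Conjunction counts 2 so that `(φ ∧' ψ) ⇒ χ` outweighs `φ ⇒ (ψ ⇒ χ)`, which trades the conjunction
-- for a second implication.
weight : Form → ℕ
weight (var _) = 1
weight ⊥' = 1
weight (φ ∧' ψ) = 2 + weight φ + weight ψ
weight (φ ∨' ψ) = 1 + weight φ + weight ψ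
weight (φ ⇒ ψ) = 1 + weight φ + weight ψ
weight (□ φ) = 1 + weight φ
weight (◇ φ) = 1 + weight φ

-- The base 3 makes a formula outweigh any two formulas of smaller weight, so that the Dershowitz–Manna
-- order on multisets, in which every rule of the calculus descends, becomes an order of numbers.
cost : Form → ℕ
cost φ = 3 ^ weight φ

μ : List Form → ℕ
μ Γ = sum (map cost Γ)

μM : Maybe Form → ℕ
μM nothing = 0
μM (just φ) = cost φ

μ-++ : ∀ Γ Θ → μ (Γ ++ Θ) ≡ μ Γ + μ Θ
μ-++ Γ Θ rewrite map-++ cost Γ Θ = sum-++ (map cost Γ) (map cost Θ)

μ-↭ : Γ ↭ Γ' → μ Γ ≡ μ Γ'
μ-↭ r = sum-↭ (Perm.map⁺ cost r)

1≤weight : ∀ φ → 1 ≤ weight φ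
1≤weight (var _) = s≤s z≤n
1≤weight ⊥' = s≤s z≤n
1≤weight (_ ∧' _) = s≤s z≤n
1≤weight (_ ∨' _) = s≤s z≤n
1≤weight (_ ⇒ _) = s≤s z≤n
1≤weight (□ _) = s≤s z≤n
1≤weight (◇ _) = s≤s z≤n

1≤cost : ∀ φ → 1 ≤ cost φ
1≤cost φ = ℕ.m^n>0 3 (weight φ)

-- With `weight x` equal to `suc v`, the three copies of `3 ^ v` in `cost x` pay for `a`, for `b`
-- and for the 2, because `v` is at least 1.
cost₂ : ∀ a b x → weight a < weight x → weight b < weight x → 2 + μ (a ∷ b ∷ []) ≤ cost x
cost₂ a b x p q with weight x
cost₂ a b x (s≤s {n = v} p) (s≤s q) | .(suc v) = begin
  2 + (cost a + (cost b + 0))   ≤⟨ ℕ.+-mono-≤ {2} {3 ^ v} 2≤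
                                     (ℕ.+-mono-≤ (ℕ.^-monoʳ-≤ 3 p) (ℕ.+-monoˡ-≤ 0 (ℕ.^-monoʳ-≤ 3 q))) ⟩
  3 ^ v + (3 ^ v + (3 ^ v + 0)) ∎
  where
  open ℕ.≤-Reasoning
  2≤ : 2 ≤ 3 ^ v
  2≤ = ℕ.≤-trans (s≤s (s≤s z≤n)) (ℕ.^-monoʳ-≤ 3 (ℕ.≤-trans (1≤weight a) p))

cost₁ : ∀ a x → weight a < weight x → 2 + cost a ≤ cost x
cost₁ a x p = ℕ.≤-trans (s≤s (s≤s (ℕ.m≤m+n (cost a) _))) (cost₂ a a x p p)

mutual
  -- Strictness for a nonempty antecedent pays for the unit of fuel spent on the boxed conjunct.
  boxInv-μ-< : ∀ x Γ → μ (boxInv (x ∷ Γ)) < μ (x ∷ Γ)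
  boxInv-μ-< x@(var _) Γ = ℕ.+-mono-≤ (1≤cost x) (boxInv-μ Γ)
  boxInv-μ-< ⊥' Γ = ℕ.+-mono-≤ (1≤cost ⊥') (boxInv-μ Γ)
  boxInv-μ-< x@(_ ∧' _) Γ = ℕ.+-mono-≤ (1≤cost x) (boxInv-μ Γ)
  boxInv-μ-< x@(_ ∨' _) Γ = ℕ.+-mono-≤ (1≤cost x) (boxInv-μ Γ)
  boxInv-μ-< x@(_ ⇒ _) Γ = ℕ.+-mono-≤ (1≤cost x) (boxInv-μ Γ)
  boxInv-μ-< (□ φ) Γ = ℕ.+-mono-≤ (ℕ.<⇒≤ (cost₁ φ (□ φ) ℕ.≤-refl)) (boxInv-μ Γ)
  boxInv-μ-< x@(◇ _) Γ = ℕ.+-mono-≤ (1≤cost x) (boxInv-μ Γ)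

  boxInv-μ : ∀ Γ → μ (boxInv Γ) ≤ μ Γ
  boxInv-μ [] = z≤n
  boxInv-μ (x ∷ Γ) = ℕ.<⇒≤ (boxInv-μ-< x Γ)

diaInv-μ : ∀ Δ → μM (diaInv Δ) ≤ μM Δ
diaInv-μ Δ with diaInv-view Δ
... | inj₁ (δ , refl) = ℕ.^-monoʳ-≤ 3 (ℕ.n≤1+n (weight δ))
... | inj₂ eq rewrite eq = z≤n

-- Charges `γ` to the diamond it comes from, so that in `◇⇒L` the implication has to pay only for
-- the new succedent.
boxInv-μ-diamond : ∀ {γ} → ◇ γ ∈ Γ → μ (γ ∷ boxInv Γ) ≤ μ Γ
boxInv-μ-diamond {γ = γ} i with Γ₀ , r ← ∈⇒↭∷ i rewrite μ-↭ r | μ-↭ (boxInv-↭ r) =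
  ℕ.+-mono-≤ (ℕ.^-monoʳ-≤ 3 (ℕ.n≤1+n (weight γ))) (boxInv-μ Γ₀)

-- gs is the new part of a premise antecedent or succedent that replaces the principal formula x.
infix 3 _≺_
_≺_ : List Form → Form → Set
gs ≺ x = 2 + μ gs ≤ cost x

≺₁ : ∀ a x → weight a < weight x → a ∷ [] ≺ x
≺₁ a x p = subst (λ c → 2 + c ≤ cost x) (sym (ℕ.+-identityʳ (cost a))) (cost₁ a x p)

≺-head : ∀ {a b} → a ∷ b ∷ [] ≺ x → a ∷ [] ≺ x
≺-head {a = a} = ℕ.≤-trans (s≤s (s≤s (ℕ.+-monoʳ-≤ (cost a) z≤n)))

≺-tail : ∀ {a} → a ∷ gs ≺ x → gs ≺ x
≺-tail {gs = gs} {a = a} = ℕ.≤-trans (s≤s (s≤s (ℕ.m≤n+m (μ gs) (cost a))))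

⇒≺ : ∀ φ ψ → ψ ∷ [] ≺ φ ⇒ ψ
⇒≺ φ ψ = ≺₁ ψ (φ ⇒ ψ) (s≤s (ℕ.m≤n+m _ _))

modal-⇒≺ : ∀ φ ψ → weight x ≡ suc (weight φ) → φ ∷ [] ≺ x ⇒ ψ
modal-⇒≺ {x = x} φ ψ eq = ≺₁ φ (x ⇒ ψ) (s≤s (ℕ.m≤n⇒m≤n+o _ (subst (weight φ ≤_) (sym eq) (ℕ.n≤1+n _))))

∧≺ : ∀ φ ψ → φ ∷ ψ ∷ [] ≺ φ ∧' ψ
∧≺ φ ψ = cost₂ φ ψ (φ ∧' ψ) (s≤s (ℕ.m≤n⇒m≤1+n (ℕ.m≤m+n _ _))) (s≤s (ℕ.m≤n⇒m≤1+n (ℕ.m≤n+m _ _)))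

∨≺₁ : ∀ φ ψ → φ ∷ [] ≺ φ ∨' ψ
∨≺₁ φ ψ = ≺₁ φ (φ ∨' ψ) (s≤s (ℕ.m≤m+n _ _))

∨≺₂ : ∀ φ ψ → ψ ∷ [] ≺ φ ∨' ψ
∨≺₂ φ ψ = ≺₁ ψ (φ ∨' ψ) (s≤s (ℕ.m≤n+m _ _))

⇒≺₂ : ∀ φ ψ → ψ ∷ φ ∷ [] ≺ φ ⇒ ψ
⇒≺₂ φ ψ = cost₂ ψ φ (φ ⇒ ψ) (s≤s (ℕ.m≤n+m _ _)) (s≤s (ℕ.m≤m+n _ _))

∧⇒≺ : ∀ φ ψ χ → (φ ⇒ (ψ ⇒ χ)) ∷ [] ≺ (φ ∧' ψ) ⇒ χ
∧⇒≺ φ ψ χ = ≺₁ (φ ⇒ (ψ ⇒ χ)) ((φ ∧' ψ) ⇒ χ) (s≤s (s≤s (ℕ.≤-reflexive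
  (Eq.trans (ℕ.+-suc (weight φ) _) (cong suc (sym (ℕ.+-assoc (weight φ) (weight ψ) (weight χ))))))))

∨⇒≺ : ∀ φ ψ χ → (φ ⇒ χ) ∷ (ψ ⇒ χ) ∷ [] ≺ (φ ∨' ψ) ⇒ χ
∨⇒≺ φ ψ χ = cost₂ (φ ⇒ χ) (ψ ⇒ χ) ((φ ∨' ψ) ⇒ χ)
  (s≤s (s≤s (ℕ.+-monoˡ-≤ (weight χ) (ℕ.m≤m+n _ _)))) (s≤s (s≤s (ℕ.+-monoˡ-≤ (weight χ) (ℕ.m≤n+m _ _))))

⇒⇒≺ : ∀ φ ψ χ → (φ ⇒ ψ) ∷ (ψ ⇒ χ) ∷ [] ≺ (φ ⇒ ψ) ⇒ χ
⇒⇒≺ φ ψ χ = cost₂ (φ ⇒ ψ) (ψ ⇒ χ) ((φ ⇒ ψ) ⇒ χ)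
  (s≤s (ℕ.m≤m+n _ _))
  (s≤s (s≤s (ℕ.+-monoˡ-≤ (weight χ) (ℕ.m≤n+m _ _))))

-- Descent of the measure from conclusion to premises.

module Bounds (i : (x , Γ₀) ∈ picks Γ) where
  module _ {n k : ℕ} (h : μ Γ + k ≤ suc n) where

    -- Of the 2 spare units in `_≺_`, one pays for the step from `suc n` to `n`, the other for the
    -- strict bound on the fuel of A. Here `k` and `k'` measure succedents.
    descend : ∀ {c g k'} → 2 + c ≤ cost x → g ≤ μ Γ₀ → k' ≤ k → c + g + k' < n
    descend {c} {g} {k'} s g≤ k≤ = ℕ.≤-pred (begin
      2 + (c + g + k')   ≤⟨ ℕ.+-mono-≤ (ℕ.+-mono-≤ s g≤) k≤ ⟩
      cost x + μ Γ₀ + k  ≡⟨ cong (_+ k) (sym (μ-↭ (∈-picks⁻ i))) ⟩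
      μ Γ + k            ≤⟨ h ⟩
      suc n ∎)
      where open ℕ.≤-Reasoning

    descend-Γ : ∀ gs {k'} → gs ≺ x → k' ≤ k → μ (gs ++ Γ₀) + k' < n
    descend-Γ gs s k≤ rewrite μ-++ gs Γ₀ = descend s ℕ.≤-refl k≤

    descend-□ : ∀ gs {k'} → gs ≺ x → k' ≤ k → μ (gs ++ boxInv Γ₀) + k' < n
    descend-□ gs s k≤ rewrite μ-++ gs (boxInv Γ₀) = descend s (boxInv-μ Γ₀) k≤

  module _ {n : ℕ} (h : μ Γ ≤ suc n) where

    private
      h+0 : μ Γ + 0 ≤ suc n
      h+0 = subst (_≤ suc n) (sym (ℕ.+-identityʳ _)) h

    principal-Γ : ∀ gs → gs ≺ x → μ (gs ++ Γ₀) ≤ n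
    principal-Γ gs s = ℕ.<⇒≤ (subst (_< n) (ℕ.+-identityʳ _) (descend-Γ h+0 gs s z≤n))

    principal-□ : ∀ gs → gs ≺ x → μ (gs ++ boxInv Γ₀) ≤ n
    principal-□ gs s = ℕ.<⇒≤ (subst (_< n) (ℕ.+-identityʳ _) (descend-□ h+0 gs s z≤n))

    -- The premise discards `Δ`, so the principal formula pays for the new succedent `δ` as well as
    -- for `gs`.
    principal-Δ : ∀ δ gs {g} → δ ∷ gs ≺ x → g ≤ μ Γ₀ → μ gs + g + cost δ < n
    principal-Δ δ gs {g} s g≤ rewrite ℕ.+-comm (μ gs + g) (cost δ) | sym (ℕ.+-assoc (cost δ) (μ gs) g)
                              = subst (_< n) (ℕ.+-identityʳ _) (descend h+0 s g≤ z≤n)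

-- Here `x` is the succedent of the conclusion, and `g` measures what the premise retains of `Γ`,
-- whole or unboxed.
succedent-Δ : ∀ {n} x δ gs {g} → δ ∷ gs ≺ x → g ≤ μ Γ → μ Γ + cost x < suc n → μ gs + g + cost δ < n
succedent-Δ {Γ = Γ} {n} x δ gs {g} s g≤ h = ℕ.≤-pred (begin
  2 + (μ gs + g + cost δ)   ≡⟨ cong (2 +_) (Eq.trans (ℕ.+-comm (μ gs + g) (cost δ))
                                                     (sym (ℕ.+-assoc (cost δ) (μ gs) g))) ⟩
  2 + (cost δ + μ gs) + g   ≤⟨ ℕ.+-mono-≤ s g≤ ⟩
  cost x + μ Γ              ≡⟨ ℕ.+-comm (cost x) (μ Γ) ⟩
  μ Γ + cost x              ≤⟨ ℕ.<⇒≤ h ⟩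
  suc n ∎)
  where open ℕ.≤-Reasoning

split : ∀ Π → x ∷ Σ₀ ↭ Π ++ Γ → (∃ λ Π₀ → Π ↭ x ∷ Π₀ × Σ₀ ↭ Π₀ ++ Γ)
                              ⊎ (∃ λ Γ₀ → (x , Γ₀) ∈ picks Γ × Σ₀ ↭ Π ++ Γ₀)
split Π r with ∈-++⁻ Π (∈-resp-↭ r (here refl))
... | inj₁ i with Π₀ , s ← ∈⇒↭∷ i = inj₁ (Π₀ , s , drop-∷ (trans r (++⁺ʳ _ s)))
... | inj₂ i with Γ₀ , j ← ∈-picks⁺ i =
  inj₂ (Γ₀ , j , drop-∷ (trans r (trans (++⁺ˡ Π (∈-picks⁻ j)) (shift _ Π Γ₀))))

∈-mapMaybe⁺ : {X Y : Set} (g : X → Maybe Y) {a : X} {b : Y} {as : List X} →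
              a ∈ as → g a ≡ just b → b ∈ mapMaybe g as
∈-mapMaybe⁺ g (here refl) eq rewrite eq = here refl
∈-mapMaybe⁺ g {as = a ∷ _} (there i) eq with g a
... | just _ = there (∈-mapMaybe⁺ g i eq)
... | nothing = ∈-mapMaybe⁺ g i eq

-- Uniformity.

module Uniformity (p : Var) where

  Fresh : Form → Set
  Fresh φ = ¬ Occ p φ

  -- The two halves of uniformity need each other: a left rule acting on `Π` asks for `keep` in a
  -- premise whose succedent comes from `Π`, and `ea-intro` asks for `quant`.
  data Goal (Γ : List Form) (Δ : Maybe Form) : Maybe Form → Set where
    keep  : ¬ OccM p Δ → Goal Γ Δ Δ
    quant : ∀ n → μ Γ + μM Δ < n → Goal Γ Δ (just (A' p n Γ Δ))

  -- E is kept as the list of its conjuncts, so that one can be used and the others retained. Its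
  -- fuel `m` is independent of the fuel in `quant`: a right rule lowers only the latter.
  Uniform : List Form → List Form → Maybe Form → Set
  Uniform Π Γ Δ = ∀ {Δ'} m → μ Γ ≤ m → Goal Γ Δ Δ' → Π ++ EL p m Γ ⊢ Δ'

  module At n = Clauses p (E' p n) (A' p n)

  ∈-EL : ∀ n {c} → (x , Γ₀) ∈ picks Γ → c ∈ At.eL n x Γ₀ → c ∈ EL p (suc n) Γ
  ∈-EL n i j = there (∈-concatMap⁺ _ (lose i j))

  A'-L : ∀ n {c} → (x , Γ₀) ∈ picks Γ → c ∈ At.aL n x Γ₀ Δ → Θ ⊢ just c → Θ ⊢ just (A' p (suc n) Γ Δ)
  A'-L {Γ = Γ} {Δ = Δ} n i j = ⋁R (there (∈-++⁺ʳ (At.aR n Γ Δ) (∈-concatMap⁺ _ (lose i j))))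

  A'-R : ∀ n Γ φ {c} → c ∈ At.aR n Γ (just φ) → Θ ⊢ just c → Θ ⊢ just (A' p (suc n) Γ (just φ))
  A'-R n Γ φ j = ⋁R (there (∈-++⁺ˡ j))

  wk-++ : ∀ Θ → Π ⊢ Δ → Π ++ Θ ⊢ Δ
  wk-++ Θ = wk (Θ , refl)

  wk-boxInv : ∀ Π Θ → boxInv Π ⊢ Δ → boxInv (Π ++ Θ) ⊢ Δ
  wk-boxInv Π Θ = wk (⊑-boxInv {Γ = Π} (Θ , refl))

  wk-boxInv∷ : ∀ Π Θ → y ∷ boxInv Π ⊢ Δ → y ∷ boxInv (Π ++ Θ) ⊢ Δ
  wk-boxInv∷ Π Θ = wk (⊑-prep (⊑-boxInv {Γ = Π} (Θ , refl)))

  positive : ∀ {m} → (x , Γ₀) ∈ picks Γ → μ Γ ≤ m → ∃ λ n → m ≡ suc n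
  positive {x = x} {m = zero} i h rewrite μ-↭ (∈-picks⁻ i) =
    case ℕ.≤-trans (1≤cost x) (ℕ.m+n≤o⇒m≤o (cost x) h) of λ ()
  positive {m = suc n} i h = n , refl

  -- The continuation learns which conjuncts `Θ` remain, so that a rule preserving its atom or
  -- diamond can rebuild the whole list.
  use : ∀ {m} Π → (x , Γ₀) ∈ picks Γ → μ Γ ≤ m →
        (∀ {n} → μ Γ ≤ suc n → ∃ λ c → c ∈ At.eL n x Γ₀ ×
          (∀ {Θ} → EL p m Γ ↭ c ∷ Θ → c ∷ Π ++ Θ ⊢ Δ)) →
        Π ++ EL p m Γ ⊢ Δ
  use Π i h k with n , refl ← positive i h with c , j , d ← k h with Θ , r ← ∈⇒↭∷ (∈-EL n i j) =
    exch (↭-sym (trans (++⁺ˡ Π r) (shift c Π Θ))) (d r)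

  ea-intro : ∀ n → μ Γ + μM Δ < n → Uniform Π Γ Δ → Π ⊢ just (At.ea n Γ Δ)
  ea-intro {Γ = Γ} n l ih = ⇒R (⋀L (EL p n Γ) (ih n (ℕ.m+n≤o⇒m≤o (μ Γ) (ℕ.<⇒≤ l)) (quant n l)))

  -- A left rule with principal formula x in Γ: how its conjunct of E carries the last premise over to
  -- the conclusion, and how its disjunct of A follows from the A of the last premise.
  principal : ∀ {m Π'} Π gs → (x , Γ₀) ∈ picks Γ → μ Γ ≤ m → gs ≺ x →
    (∀ {n C'} → μ Γ ≤ suc n → E' p n (gs ++ Γ₀) ∷ Π' ⊢ C' → ∃ λ c → c ∈ At.eL n x Γ₀ × c ∷ Π ⊢ C') →
    (∀ {n} → μ Γ ≤ suc n → Π ++ EL p m Γ ⊢ just (A' p n (gs ++ Γ₀) Δ) →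
      ∃ λ c → c ∈ At.aL n x Γ₀ Δ × Π ++ EL p m Γ ⊢ just c) →
    Uniform Π' (gs ++ Γ₀) Δ → Goal Γ Δ Δ' → Π ++ EL p m Γ ⊢ Δ'
  principal Π gs i h s elim intro ih (keep f) = use Π i h λ h' →
    let c , j , d = elim h' (⋀L _ (ih _ (Bounds.principal-Γ i h' gs s) (keep f)))
    in c , j , λ _ → wk-++ _ d
  principal {Γ = Γ} Π gs i h s elim intro ih (quant (suc n) b) =
    let b' = ℕ.<⇒≤ b
        c , j , d = intro (ℕ.m+n≤o⇒m≤o (μ Γ) b') (use Π i h λ h' →
          let c , j , d = elim h' (⋀L _ (ih _ (Bounds.principal-Γ i h' gs s)
                                            (quant n (Bounds.descend-Γ i b' gs s ℕ.≤-refl))))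
          in c , j , λ _ → wk-++ _ d)
    in A'-L n i j d

  -- For Γ = ∅ there need not be a boxed conjunct, but then E of Γ and of boxInv Γ are both trivial.
  boxed : ∀ {m} Ψ → μ Γ ≤ m → (∀ m' → μ (boxInv Γ) ≤ m' → Ψ ++ EL p m' (boxInv Γ) ⊢ Δ) →
          Ψ ++ boxInv (EL p m Γ) ⊢ Δ
  boxed {Γ = []} {m = zero} Ψ h ih = ih zero z≤n
  boxed {Γ = x ∷ Γ} {m = zero} Ψ h ih = case ℕ.≤-trans (1≤cost x) (ℕ.m+n≤o⇒m≤o _ h) of λ ()
  boxed {Γ = Γ} {m = suc n} Ψ h ih =
    exch (↭-sym (shift (E' p n (boxInv Γ)) Ψ (boxInv rest)))
      (wk-++ {Π = E' p n (boxInv Γ) ∷ Ψ} (boxInv rest) (⋀L (EL p n (boxInv Γ)) (ih n (boxInv-≤ Γ h))))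
    where
    rest : List Form
    rest = concatMap (λ (x , Γ₀) → At.eL n x Γ₀) (picks Γ)
    boxInv-≤ : ∀ Γ → μ Γ ≤ suc n → μ (boxInv Γ) ≤ n
    boxInv-≤ [] h = z≤n
    boxInv-≤ (x ∷ Γ) h = ℕ.≤-pred (ℕ.≤-trans (boxInv-μ-< x Γ) h)

  diaInv-fresh : ∀ Δ → ¬ OccM p Δ → ¬ OccM p (diaInv Δ)
  diaInv-fresh Δ f o with diaInv-view Δ
  ... | inj₁ (δ , refl) = f (◇o o)
  ... | inj₂ eq rewrite eq = o

  ∷-Γ : ∀ gs → Σ₀ ↭ Π ++ Γ → gs ++ Σ₀ ↭ Π ++ gs ++ Γ
  ∷-Γ {Π = Π} gs s = trans (++⁺ˡ gs s) (shifts gs Π)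

  head-fresh : All Fresh Π → Π ↭ x ∷ Γ₀ → Fresh x
  head-fresh π a = All.head (All-resp-↭ a π)

  tail-fresh : All Fresh Π → Π ↭ x ∷ Γ₀ → All Fresh Γ₀
  tail-fresh π a = All.tail (All-resp-↭ a π)

  boxInv-fresh : All Fresh Π → All Fresh (boxInv Π)
  boxInv-fresh π = All.map (λ v o → v p o refl)
    (boxInv-VarsIn {U = λ q → ¬ q ≡ p} (All.map (λ { f q o refl → f o }) π))

  -- Structural on the derivation: the division into `Π` and `Γ` is a separate permutation, so
  -- formulas are redistributed without altering the derivations of the premises. The bounds on fuel
  -- guarantee that the selected conjuncts and disjuncts are present.
  uniform : Σ' ⊢ Δ → Σ' ↭ Π ++ Γ → All Fresh Π → Uniform Π Γ Δ
  uniform {Π = Π} (⊥L r) s π m h t with split Π (trans (↭-sym r) s)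
  ... | inj₁ (_ , a , _) = ⊥L (++⁺ʳ _ a)
  ... | inj₂ (_ , i , _) = use Π i h λ _ → _ , here refl , λ _ → ⊥L refl
  uniform {Π = Π} (IdP r) s π m h t with split Π (trans (↭-sym r) s)
  uniform (IdP r) s π m h (keep f) | inj₁ (_ , a , _) = IdP (++⁺ʳ _ a)
  uniform {Γ = Γ} (IdP {p = q} r) s π m h (quant (suc n) b) | inj₁ (_ , a , _) =
    A'-R n Γ (var q) (∈-when (¬? (q ≟ p)) (λ { refl → head-fresh π a here }) (here refl)) (IdP (++⁺ʳ _ a))
  uniform {Π = Π} (IdP {p = q} r) s π m h (keep f) | inj₂ (_ , i , _) =
    use Π i h λ _ → _ , ∈-when (¬? (q ≟ p)) (λ { refl → f here }) (here refl) , λ _ → IdP refl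
  uniform (IdP {p = q} r) s π m h (quant (suc n) b) | inj₂ (_ , i , _) =
    -- Only in this case can `q` be `p`; the disjunct `⊤'` does not mention it.
    A'-L n i (∈-when (q ≟ q) refl (here refl)) ⊤R
  uniform {Π = Π} (∧L {φ = φ} {ψ} r d) s π m h t with split Π (trans (↭-sym r) s)
  ... | inj₁ (_ , a , s') = ∧L (++⁺ʳ _ a)
    (uniform d (prep _ (prep _ s'))
      ((head-fresh π a ∘ ∧l) ∷ (head-fresh π a ∘ ∧r) ∷ tail-fresh π a) m h t)
  ... | inj₂ (_ , i , s') = principal Π (φ ∷ ψ ∷ []) i h (∧≺ φ ψ)
    (λ _ d' → _ , here refl , d') (λ _ d' → _ , here refl , d') (uniform d (∷-Γ (φ ∷ ψ ∷ []) s') π) t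
  uniform (∧R d e) s π m h (keep f) =
    ∧R (uniform d s π m h (keep (f ∘ ∧l))) (uniform e s π m h (keep (f ∘ ∧r)))
  uniform {Γ = Γ} (∧R {φ = φ} {ψ} d e) s π m h (quant (suc n) b) = A'-R n Γ (φ ∧' ψ) (here refl)
    (∧R (uniform d s π m h (quant n (succedent-Δ {Γ = Γ} (φ ∧' ψ) φ []
          (≺-head {φ ∧' ψ} {φ} {ψ} (∧≺ φ ψ)) ℕ.≤-refl b)))
        (uniform e s π m h (quant n (succedent-Δ {Γ = Γ} (φ ∧' ψ) ψ []
          (≺-tail {ψ ∷ []} {φ ∧' ψ} {φ} (∧≺ φ ψ)) ℕ.≤-refl b))))
  uniform {Π = Π} (∨L {φ = φ} {ψ} r d e) s π m h t with split Π (trans (↭-sym r) s)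
  ... | inj₁ (_ , a , s') = ∨L (++⁺ʳ _ a)
    (uniform d (prep _ s') ((head-fresh π a ∘ ∨l) ∷ tail-fresh π a) m h t)
    (uniform e (prep _ s') ((head-fresh π a ∘ ∨r) ∷ tail-fresh π a) m h t)
  uniform {Π = Π} (∨L {φ = φ} {ψ} r d e) s π m h (keep f) | inj₂ (_ , i , s') = use Π i h λ h' →
    _ , here refl , λ _ → wk-++ {Π = _ ∷ Π} _ (∨L refl
      (⋀L _ (uniform d (∷-Γ (φ ∷ []) s') π _ (Bounds.principal-Γ i h' (φ ∷ []) (∨≺₁ φ ψ)) (keep f)))
      (⋀L _ (uniform e (∷-Γ (ψ ∷ []) s') π _ (Bounds.principal-Γ i h' (ψ ∷ []) (∨≺₂ φ ψ)) (keep f))))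
  uniform {Π = Π} (∨L {φ = φ} {ψ} r d e) s π m h (quant (suc n) b) | inj₂ (_ , i , s') =
    let b' = ℕ.<⇒≤ b in
    A'-L n i (here refl) (wk-++ _ (∧R
      (ea-intro n (Bounds.descend-Γ i b' (φ ∷ []) (∨≺₁ φ ψ) ℕ.≤-refl) (uniform d (∷-Γ (φ ∷ []) s') π))
      (ea-intro n (Bounds.descend-Γ i b' (ψ ∷ []) (∨≺₂ φ ψ) ℕ.≤-refl) (uniform e (∷-Γ (ψ ∷ []) s') π))))
  uniform (∨R₁ d) s π m h (keep f) = ∨R₁ (uniform d s π m h (keep (f ∘ ∨l)))
  uniform {Γ = Γ} (∨R₁ {φ = φ} {ψ} d) s π m h (quant (suc n) b) = A'-R n Γ (φ ∨' ψ) (here refl)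
    (uniform d s π m h (quant n (succedent-Δ {Γ = Γ} (φ ∨' ψ) φ [] (∨≺₁ φ ψ) ℕ.≤-refl b)))
  uniform (∨R₂ d) s π m h (keep f) = ∨R₂ (uniform d s π m h (keep (f ∘ ∨r)))
  uniform {Γ = Γ} (∨R₂ {φ = φ} {ψ} d) s π m h (quant (suc n) b) = A'-R n Γ (φ ∨' ψ) (there (here refl))
    (uniform d s π m h (quant n (succedent-Δ {Γ = Γ} (φ ∨' ψ) ψ [] (∨≺₂ φ ψ) ℕ.≤-refl b)))
  uniform (⇒R d) s π m h (keep f) =
    ⇒R (uniform d (prep _ s) ((f ∘ ⇒l) ∷ π) m h (keep (f ∘ ⇒r)))
  uniform {Γ = Γ} (⇒R {φ = φ} {ψ} d) s π m h (quant (suc n) b) = A'-R n Γ (φ ⇒ ψ) (here refl)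
    (wk-++ _ (ea-intro n (subst (_< n) (cong (_+ cost ψ) (sym (μ-++ (φ ∷ []) Γ)))
                          (succedent-Δ {Γ = Γ} (φ ⇒ ψ) ψ (φ ∷ []) (⇒≺₂ φ ψ) ℕ.≤-refl b))
                       (uniform d (∷-Γ (φ ∷ []) s) π)))
  uniform {Π = Π} (∧⇒L {φ = φ} {ψ} {χ} r d) s π m h t with split Π (trans (↭-sym r) s)
  ... | inj₁ (_ , a , s') = ∧⇒L (++⁺ʳ _ a) (uniform d (prep _ s')
    ((λ { (⇒l o) → head-fresh π a (⇒l (∧l o))
        ; (⇒r (⇒l o)) → head-fresh π a (⇒l (∧r o))
        ; (⇒r (⇒r o)) → head-fresh π a (⇒r o) }) ∷ tail-fresh π a) m h t)
  ... | inj₂ (_ , i , s') = principal Π (_ ∷ []) i h (∧⇒≺ φ ψ χ)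
    (λ _ d' → _ , here refl , d') (λ _ d' → _ , here refl , d') (uniform d (∷-Γ (_ ∷ []) s') π) t
  uniform {Π = Π} (∨⇒L {φ = φ} {ψ} {χ} r d) s π m h t with split Π (trans (↭-sym r) s)
  ... | inj₁ (_ , a , s') = ∨⇒L (++⁺ʳ _ a) (uniform d (prep _ (prep _ s'))
    ((λ { (⇒l o) → head-fresh π a (⇒l (∨l o)) ; (⇒r o) → head-fresh π a (⇒r o) }) ∷
     (λ { (⇒l o) → head-fresh π a (⇒l (∨r o)) ; (⇒r o) → head-fresh π a (⇒r o) }) ∷ tail-fresh π a) m h t)
  ... | inj₂ (_ , i , s') = principal Π (_ ∷ _ ∷ []) i h (∨⇒≺ φ ψ χ)
    (λ _ d' → _ , here refl , d') (λ _ d' → _ , here refl , d') (uniform d (∷-Γ (_ ∷ _ ∷ []) s') π) t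
  uniform {Π = Π} {Γ = Γ} (⇒⇒L {φ = φ} {ψ} {χ} r d e) s π m h t with split Π (trans (↭-sym r) s)
  ... | inj₁ (_ , a , s') = ⇒⇒L (++⁺ʳ _ a)
    -- The succedent of the left premise is part of a formula of `Π`, hence p-free, and `keep`
    -- applies whatever the goal `t` is.
    (uniform d (prep _ s')
      ((λ { (⇒l o) → head-fresh π a (⇒l (⇒r o)) ; (⇒r o) → head-fresh π a (⇒r o) }) ∷ tail-fresh π a)
      m h (keep (head-fresh π a ∘ ⇒l)))
    (uniform e (prep _ s') ((head-fresh π a ∘ ⇒r) ∷ tail-fresh π a) m h t)
  ... | inj₂ (Γ₀ , i , s') = principal Π (χ ∷ []) i h (⇒≺ (φ ⇒ ψ) χ)
    (λ h' d' → _ , here refl , ⇒L (left h') d') (λ h' d' → _ , here refl , ∧R (wk-++ _ (left h')) d')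
    (uniform e (∷-Γ (χ ∷ []) s') π) t
    where
    left : ∀ {n} → μ Γ ≤ suc n → Π ⊢ just (At.ea n ((ψ ⇒ χ) ∷ Γ₀) (just (φ ⇒ ψ)))
    left {n} h' = ea-intro n (subst (_< n) (cong (_+ cost (φ ⇒ ψ)) (sym (μ-++ ((ψ ⇒ χ) ∷ []) Γ₀)))
                         (Bounds.principal-Δ i h' (φ ⇒ ψ) ((ψ ⇒ χ) ∷ []) (⇒⇒≺ φ ψ χ) ℕ.≤-refl))
                       (uniform d (∷-Γ (_ ∷ []) s') π)
  uniform {Π = Π} (p⇒L {p = q} {φ} r d) s π m h t with split Π (trans (↭-sym r) s)
  uniform {Π = Π} (p⇒L {p = q} {φ} r d) s π m h t | inj₁ (Π₀ , a , s') with split Π₀ s'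
  ... | inj₁ (_ , a' , s″) = p⇒L (++⁺ʳ _ (trans a (prep _ a'))) (uniform d (prep _ (prep _ s″))
    (head-fresh π a ∷ (head-fresh (tail-fresh π a) a' ∘ ⇒r) ∷ tail-fresh (tail-fresh π a) a') m h t)
  ... | inj₂ (Γ₀ , i , s″) = principal {Π' = var q ∷ Π₀} Π (φ ∷ []) i h (⇒≺ (var q) φ)
    (λ _ d' → _ , ∈-++⁺ˡ (∈-when (¬? (q ≟ p)) q≢p (here refl)) , p⇒L (under a) (exch (swap _ _ refl) d'))
    (λ _ d' → _ , ∈-++⁺ˡ (∈-when (¬? (q ≟ p)) q≢p (here refl)) , ∧R (IdP (++⁺ʳ _ a)) d')
    (uniform d (prep _ (∷-Γ (φ ∷ []) s″)) (head-fresh π a ∷ tail-fresh π a)) t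
    where
    q≢p : ¬ q ≡ p
    q≢p refl = head-fresh π a here
  uniform {Π = Π} {Γ = Γ} (p⇒L {p = q} {φ} r d) s π m h t | inj₂ (Γ₀ , i , s') with split Π s'
  -- The atom lies in `Γ`, the implication in `Π`, so `q` is not `p` and the conjunct `var q` serves
  -- as the atom. The rule preserves it, hence the induction hypothesis is applied to the same `Γ`
  -- and the full list of conjuncts.
  ... | inj₁ (Π₀ , a , s″) = use Π i h λ _ → _ , ∈-when (¬? (q ≟ p)) q≢p (here refl) , λ r' →
    p⇒L (prep _ (++⁺ʳ _ a)) (exch (trans (++⁺ˡ (φ ∷ Π₀) r') (shift _ (φ ∷ Π₀) _))
      (uniform d (trans (swap _ _ s″) (prep φ (trans (↭-sym (shift _ Π₀ _)) (++⁺ˡ Π₀ (↭-sym (∈-picks⁻ i))))))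
        ((head-fresh π a ∘ ⇒r) ∷ tail-fresh π a) m h t))
    where
    q≢p : ¬ q ≡ p
    q≢p refl = head-fresh π a (⇒l here)
  ... | inj₂ (Γ₁ , j , s″) with Γ₂ , k , q∷Γ₁ ← picks-swap i j =
    principal Π (φ ∷ []) k h (⇒≺ (var q) φ)
      (λ _ d' → _ , ∈-++⁺ʳ _ (∈-when (q ∈? atoms Γ₂) q∈Γ₂ (here refl)) , d')
      (λ _ d' → _ , ∈-++⁺ʳ _ (∈-when (q ∈? atoms Γ₂) q∈Γ₂ (here refl)) , d')
      (uniform d (trans (∷-Γ (var q ∷ φ ∷ []) s″) (++⁺ˡ Π (trans (swap _ _ refl) (prep φ (↭-sym q∷Γ₁))))) π) t
    where
    q∈Γ₂ : q ∈ atoms Γ₂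
    q∈Γ₂ = ∈-mapMaybe⁺ unvar (∈-resp-↭ (↭-sym q∷Γ₁) (here refl)) refl
  uniform {Π = Π} {Γ = Γ} (□R d) s π m h (keep f) =
    -- Unboxing the context turns the boxed conjunct into E of `boxInv Γ`, as the induction
    -- hypothesis expects.
    □R (subst (_⊢ _) (sym (boxInv-++ Π _)) (boxed {Γ = Γ} (boxInv Π) h λ m' h' →
      uniform d (boxInv-↭-++ Π Γ s) (boxInv-fresh π) m' h' (keep (f ∘ □o))))
  uniform {Π = Π} {Γ = Γ} (□R {φ = φ} d) s π m h (quant (suc n) b) = A'-R n Γ (□ φ) (here refl)
    (□R (wk-boxInv Π _ (ea-intro n (succedent-Δ {Γ = Γ} (□ φ) φ [] (≺₁ φ (□ φ) ℕ.≤-refl) (boxInv-μ Γ) b)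
                                   (uniform d (boxInv-↭-++ Π Γ s) (boxInv-fresh π)))))
  uniform {Π = Π} {Γ = Γ} (□⇒L {φ = φ} {ψ} r d e) s π m h t with split Π (trans (↭-sym r) s)
  ... | inj₁ (Π₀ , a , s') = □⇒L (++⁺ʳ _ a)
    (subst (_⊢ _) (sym (boxInv-++ Π₀ _)) (boxed {Γ = Γ} (boxInv Π₀) h λ m' h' →
      uniform d (boxInv-↭-++ Π₀ Γ s') (boxInv-fresh (tail-fresh π a)) m' h' (keep (head-fresh π a ∘ ⇒l ∘ □o))))
    (uniform e (prep _ s') ((head-fresh π a ∘ ⇒r) ∷ tail-fresh π a) m h t)
  ... | inj₂ (Γ₀ , i , s') = principal Π (ψ ∷ []) i h (⇒≺ (□ φ) ψ)
    (λ h' d' → _ , here refl , □⇒L refl (left h') d')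
    (λ h' d' → _ , here refl , ∧R (□R (wk-boxInv Π _ (left h'))) d')
    (uniform e (∷-Γ (ψ ∷ []) s') π) t
    where
    left : ∀ {n} → μ Γ ≤ suc n → boxInv Π ⊢ just (At.ea n (boxInv Γ₀) (just φ))
    left {n} h' = ea-intro n (Bounds.principal-Δ i h' φ [] (modal-⇒≺ {□ φ} φ ψ refl) (boxInv-μ Γ₀))
                             (uniform d (boxInv-↭-++ Π Γ₀ s') (boxInv-fresh π))
  uniform {Π = Π} {Γ = Γ} (◇⇒L {γ = γ} {φ} {ψ} r d e) s π m h t with split Π (trans (↭-sym r) s)
  uniform {Π = Π} {Γ = Γ} (◇⇒L {γ = γ} {φ} {ψ} r d e) s π m h t | inj₁ (Π₀ , a , s') with split Π₀ s'
  ... | inj₁ (Π₁ , a' , s″) = ◇⇒L (++⁺ʳ _ (trans a (prep _ a')))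
    (subst (λ Θ → γ ∷ Θ ⊢ _) (sym (boxInv-++ Π₁ _)) (boxed {Γ = Γ} (γ ∷ boxInv Π₁) h λ m' h' →
      uniform d (prep _ (boxInv-↭-++ Π₁ Γ s″))
        ((head-fresh π a ∘ ◇o) ∷ boxInv-fresh (tail-fresh (tail-fresh π a) a'))
        m' h' (keep (head-fresh (tail-fresh π a) a' ∘ ⇒l ∘ ◇o))))
    (uniform e (prep _ (prep _ s″))
      (head-fresh π a ∷ (head-fresh (tail-fresh π a) a' ∘ ⇒r) ∷ tail-fresh (tail-fresh π a) a') m h t)
  ... | inj₂ (Γ₀ , i , s″) = principal {Π' = ◇ γ ∷ Π₀} Π (ψ ∷ []) i h (⇒≺ (◇ φ) ψ)
    (λ h' d' → _ , here refl , ◇⇒L (under a) (left h') (exch (swap _ _ refl) d'))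
    (λ h' d' → _ , here refl , ∧R (◇L' (++⁺ʳ _ a) (wk-boxInv∷ Π₀ _ (left h'))) d')
    (uniform e (prep _ (∷-Γ (ψ ∷ []) s″)) (head-fresh π a ∷ tail-fresh π a)) t
    where
    left : ∀ {n} → μ Γ ≤ suc n → γ ∷ boxInv Π₀ ⊢ just (At.ea n (boxInv Γ₀) (just φ))
    left {n} h' = ea-intro n (Bounds.principal-Δ i h' φ [] (modal-⇒≺ {◇ φ} φ ψ refl) (boxInv-μ Γ₀))
                             (uniform d (prep _ (boxInv-↭-++ Π₀ Γ₀ s″))
                               ((head-fresh π a ∘ ◇o) ∷ boxInv-fresh (tail-fresh π a)))
  uniform {Π = Π} {Γ = Γ} (◇⇒L {γ = γ} {φ} {ψ} r d e) s π m h t | inj₂ (Γ₀ , i , s') with split Π s'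
  -- The diamond conjunct belonging to `◇ γ` takes its place in the rule and, like it, survives in
  -- the second premise.
  ... | inj₁ (Π₀ , a , s″) = use Π i h λ h' → _ , here refl , λ r' →
    ◇⇒L (prep _ (++⁺ʳ _ a))
      (wk-boxInv∷ Π₀ _ (⋀L _ (uniform d (∷-Γ (γ ∷ []) (boxInv-↭-++ Π₀ Γ₀ s″)) (boxInv-fresh (tail-fresh π a))
        _ (Bounds.principal-□ i h' (γ ∷ []) (≺₁ γ (◇ γ) ℕ.≤-refl)) (keep (head-fresh π a ∘ ⇒l ∘ ◇o)))))
      (exch (trans (++⁺ˡ (ψ ∷ Π₀) r') (shift _ (ψ ∷ Π₀) _))
        (uniform e (trans (swap _ _ s″) (prep ψ (trans (↭-sym (shift _ Π₀ _)) (++⁺ˡ Π₀ (↭-sym (∈-picks⁻ i))))))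
          ((head-fresh π a ∘ ⇒r) ∷ tail-fresh π a) m h t))
  ... | inj₂ (Γ₁ , j , s″) with Γ₂ , k , γ∷Γ₁ ← picks-swap i j =
    principal Π (ψ ∷ []) k h (⇒≺ (◇ φ) ψ)
      (λ h' d' → _ , there (∈-map⁺ _ (∈-mapMaybe⁺ undia γ∈Γ₂ refl)) , □⇒L refl (left h') d')
      (λ h' d' → _ , there (∈-map⁺ _ (∈-mapMaybe⁺ undia γ∈Γ₂ refl)) , ∧R (□R (wk-boxInv Π _ (left h'))) d')
      (uniform e (trans (∷-Γ (◇ γ ∷ ψ ∷ []) s″) (++⁺ˡ Π (trans (swap _ _ refl) (prep ψ (↭-sym γ∷Γ₁))))) π) t
    where
    γ∈Γ₂ : ◇ γ ∈ Γ₂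
    γ∈Γ₂ = ∈-resp-↭ (↭-sym γ∷Γ₁) (here refl)
    left : ∀ {n} → μ Γ ≤ suc n → boxInv Π ⊢ just (At.ea n (γ ∷ boxInv Γ₂) (just φ))
    left {n} h' = ea-intro n
      (Bounds.principal-Δ k h' φ [] (modal-⇒≺ {◇ φ} φ ψ refl) (boxInv-μ-diamond γ∈Γ₂))
      (uniform d (trans (∷-Γ (γ ∷ []) (boxInv-↭-++ Π Γ₁ s″))
                        (++⁺ˡ (boxInv Π) (prep γ (boxInv-↭ (↭-sym γ∷Γ₁))))) (boxInv-fresh π))
  uniform {Π = Π} (◇L' r d) s π m h t with split Π (trans (↭-sym r) s)
  uniform {Δ = Δ} {Γ = Γ} (◇L' {φ = γ} r d) s π m h (keep f) | inj₁ (Π₀ , a , s') = ◇L' (++⁺ʳ _ a)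
    (subst (λ Θ → γ ∷ Θ ⊢ _) (sym (boxInv-++ Π₀ _)) (boxed {Γ = Γ} (γ ∷ boxInv Π₀) h λ m' h' →
      uniform d (prep _ (boxInv-↭-++ Π₀ Γ s')) ((head-fresh π a ∘ ◇o) ∷ boxInv-fresh (tail-fresh π a))
        m' h' (keep (diaInv-fresh Δ f))))
  uniform {Δ = Δ} {Γ = Γ} (◇L' {φ = γ} r d) s π m h (quant (suc n) b) | inj₁ (Π₀ , a , s') with diaInv-view Δ
  ... | inj₁ (δ , refl) = ⋁R {gs = AL p (suc n) Γ _} (here refl) (◇L' (++⁺ʳ _ a) (wk-boxInv∷ Π₀ _ (ea-intro n
    (succedent-Δ {Γ = Γ} (◇ δ) δ [] (≺₁ δ (◇ δ) ℕ.≤-refl) (boxInv-μ Γ) b)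
    (uniform d (prep _ (boxInv-↭-++ Π₀ Γ s')) ((head-fresh π a ∘ ◇o) ∷ boxInv-fresh (tail-fresh π a))))))
  -- If `Γ` and `Δ` are both empty the measure does not drop, and the diamond disjunct may lack
  -- fuel. But the premise has an empty succedent, so the conclusion is derived with an empty one
  -- and weakened on the right.
  ... | inj₂ eq = rwk (◇L' (++⁺ʳ _ a)
    (subst (λ Θ → γ ∷ Θ ⊢ nothing) (sym (boxInv-++ Π₀ _)) (boxed {Γ = Γ} (γ ∷ boxInv Π₀) h λ m' h' →
      subst (_ ⊢_) eq (uniform d (prep _ (boxInv-↭-++ Π₀ Γ s'))
        ((head-fresh π a ∘ ◇o) ∷ boxInv-fresh (tail-fresh π a))
        m' h' (keep (subst (λ Δ' → ¬ OccM p Δ') (sym eq) λ ()))))))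
  uniform {Δ = Δ} {Π = Π} (◇L' {φ = γ} r d) s π m h (keep f) | inj₂ (Γ₀ , i , s') = use Π i h λ h' →
    _ , here refl , λ _ → wk-++ {Π = _ ∷ Π} _ (◇L' refl (⋀L _
      (uniform d (∷-Γ (γ ∷ []) (boxInv-↭-++ Π Γ₀ s')) (boxInv-fresh π) _
        (Bounds.principal-□ i h' (γ ∷ []) (≺₁ γ (◇ γ) ℕ.≤-refl)) (keep (diaInv-fresh Δ f)))))
  uniform {Δ = Δ} {Π = Π} (◇L' {φ = γ} r d) s π m h (quant (suc n) b) | inj₂ (Γ₀ , i , s') =
    A'-L n i (here refl) (□R (wk-boxInv Π _ (ea-intro n
      (Bounds.descend-□ i (ℕ.<⇒≤ b) (γ ∷ []) (≺₁ γ (◇ γ) ℕ.≤-refl) (diaInv-μ Δ))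
      (uniform d (∷-Γ (γ ∷ []) (boxInv-↭-++ Π Γ₀ s')) (boxInv-fresh π)))))

-- Invariance under permutation.

-- E and A are computed on sorted antecedents, which makes them literally invariant under permutation;
-- formulas are ordered by their postfix code, which a stack machine decodes.
code : Form → List ℕ
code ⊥' = 0 ∷ []
code (φ ∧' ψ) = code φ ++ code ψ ++ 1 ∷ []
code (φ ∨' ψ) = code φ ++ code ψ ++ 2 ∷ []
code (φ ⇒ ψ) = code φ ++ code ψ ++ 3 ∷ []
code (□ φ) = code φ ++ 4 ∷ []
code (◇ φ) = code φ ++ 5 ∷ []
code (var q) = 6 + q ∷ []

exec : ℕ → List Form → List Form
exec 0 st = ⊥' ∷ st
exec 1 (ψ ∷ φ ∷ st) = (φ ∧' ψ) ∷ st
exec 2 (ψ ∷ φ ∷ st) = (φ ∨' ψ) ∷ st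
exec 3 (ψ ∷ φ ∷ st) = (φ ⇒ ψ) ∷ st
exec 4 (φ ∷ st) = □ φ ∷ st
exec 5 (φ ∷ st) = ◇ φ ∷ st
exec (suc (suc (suc (suc (suc (suc q)))))) st = var q ∷ st
-- Stack underflow, which never happens on the code of a formula.
exec _ st = st

decode : List ℕ → List Form → List Form
decode cs st = foldl (λ st c → exec c st) st cs

-- The arbitrary stack carries the induction through the second operand, which is decoded on top of
-- the first.
decode-code : ∀ φ st → decode (code φ) st ≡ φ ∷ st
decode-code₂ : ∀ φ ψ c st → decode (code φ ++ code ψ ++ c ∷ []) st ≡ exec c (ψ ∷ φ ∷ st)

decode-code (var _) st = refl
decode-code ⊥' st = refl
decode-code (φ ∧' ψ) st = decode-code₂ φ ψ 1 st
decode-code (φ ∨' ψ) st = decode-code₂ φ ψ 2 st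
decode-code (φ ⇒ ψ) st = decode-code₂ φ ψ 3 st
decode-code (□ φ) st
  rewrite foldl-++ (λ st c → exec c st) st (code φ) (4 ∷ []) | decode-code φ st = refl
decode-code (◇ φ) st
  rewrite foldl-++ (λ st c → exec c st) st (code φ) (5 ∷ []) | decode-code φ st = refl

decode-code₂ φ ψ c st
  rewrite foldl-++ (λ st c → exec c st) st (code φ) (code ψ ++ c ∷ []) | decode-code φ st
        | foldl-++ (λ st c → exec c st) (φ ∷ st) (code ψ) (c ∷ []) | decode-code ψ (φ ∷ st) = refl

code-injective : ∀ {φ ψ} → code φ ≡ code ψ → φ ≡ ψ
code-injective {φ} {ψ} eq = ∷-injectiveˡ
  (Eq.trans (sym (decode-code φ [])) (Eq.trans (cong (λ c → decode c []) eq) (decode-code ψ [])))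

formOrder : DecTotalOrder _ _ _
formOrder = On.decTotalOrder (≤-decTotalOrder ℕ.<-strictTotalOrder) code

open Data.List.Sort formOrder using (sort; sort-↭; sort-↗)

-- Two sorted permutations of each other agree up to the equivalence of the order, which is equality
-- of codes, hence equality of formulas.
sort-cong : Γ ↭ Γ' → sort Γ ≡ sort Γ'
sort-cong {Γ} {Γ'} r = Pointwise-≡⇒≡ (Pointwise.map (λ eq → code-injective (Pointwise-≡⇒≡ eq))
  (Sorted.↗↭↗⇒≋ (DecTotalOrder.totalOrder formOrder) (sort-↗ Γ) (sort-↗ Γ')
    (↭⇒↭ₛ′ (DecTotalOrder.Eq.isEquivalence formOrder)
      (trans (sort-↭ Γ) (trans r (↭-sym (sort-↭ Γ')))))))

theorem5 : Σ (Var → List Form → Form) λ E →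
    Σ (Var → List Form → Maybe Form → Form) λ A →
    ((p : Var) (Γ Γ' : List Form) → Γ ↭ Γ' → E p Γ ≡ E p Γ')
    × ((p : Var) (Γ Γ' : List Form) (Δ : Maybe Form) → Γ ↭ Γ' → A p Γ Δ ≡ A p Γ' Δ)
    × ((p : Var) (Γ : List Form) (Δ : Maybe Form) →
    ((q : Var) → Occ q (E p Γ) → OccL q Γ × ¬ (q ≡ p))
    × ((q : Var) → Occ q (A p Γ Δ) → (OccL q Γ ⊎ OccM q Δ) × ¬ (q ≡ p))
    × (Γ ⊢ just (E p Γ))
    × ((A p Γ Δ ∷ Γ) ⊢ Δ)
    × ((Π : List Form) → All (λ φ → ¬ Occ p φ) Π → (Π ++ Γ) ⊢ Δ →
    ((¬ OccM p Δ) → (E p Γ ∷ Π) ⊢ Δ)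
    × ((E p Γ ∷ Π) ⊢ just (A p Γ Δ))))
theorem5 = E , A ,
  (λ p Γ Γ' r → cong (E₀ p) (sort-cong r)) ,
  (λ p Γ Γ' Δ r → cong (λ Θ → A₀ p Θ Δ) (sort-cong r)) ,
  λ p Γ Δ → let sorted = sort-↭ Γ in
    E'-free p (μ (sort Γ)) (sort Γ) (All.tabulate λ i q o → lose (∈-resp-↭ sorted i) o) ,
    A'-free p (suc (μ (sort Γ) + μM Δ)) (sort Γ) Δ
      (All.tabulate λ i q o → inj₁ (lose (∈-resp-↭ sorted i) o)) (λ q → inj₂) ,
    exch sorted (E'-sound p (μ (sort Γ)) (sort Γ)) ,
    exch (prep _ sorted) (A'-sound p (suc (μ (sort Γ) + μM Δ)) (sort Γ) Δ) ,
    λ Π fresh d →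
      let u : Uniformity.Uniform p Π (sort Γ) Δ
          u = Uniformity.uniform p d (++⁺ˡ Π (↭-sym sorted)) fresh
      in (λ f → ⋀L _ (u _ ℕ.≤-refl (Uniformity.keep f))) ,
         ⋀L _ (u _ ℕ.≤-refl (Uniformity.quant _ ℕ.≤-refl))
  where
  E₀ : Var → List Form → Form
  E₀ p Γ = E' p (μ Γ) Γ

  A₀ : Var → List Form → Maybe Form → Form
  -- The bound in `quant` is strict, hence the `suc`; E requires only `μ Γ` units of fuel.
  A₀ p Γ Δ = A' p (suc (μ Γ + μM Δ)) Γ Δ

  E : Var → List Form → Form
  E p Γ = E₀ p (sort Γ)

  A : Var → List Form → Maybe Form → Form
  A p Γ Δ = A₀ p (sort Γ) Δ
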